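{- Let $\sigma$ be a connected matching and set $\chi=123132$, $\overline{\chi}=123213$. Writing $M(z)=\mathcal{M}(\sigma,\chi,\overline{\chi},z)$, we have $$\mathcal{M}(1(\sigma+1)1,\chi,\overline{\chi},z)=\frac{1}{1-zM(z)\,C\!\left(zM(z)^{2}\right)}.$$
   Context: A matching of order $n$ is a partition of $[2n]$ into blocks (edges) of size two, identified with the word in $[n]^{2n}$ where both vertices of an edge carry the same letter and letters appear in increasing order of left vertices. A matching $\sigma$ of order $k$ is a pattern of $\tau$ if there are $i_1<\dots<i_{2k}$ with $\{i_p,i_q\}\in\tau$ iff $\{p,q\}\in\sigma$; otherwise $\tau$ avoids $\sigma$. For a set $S$ of matchings, $\mathcal{M}_n(S)$ is the set of matchings of order $n$ avoiding all of $S$, and $\mathcal{M}(S,z)=\sum_{n\ge0}|\mathcal{M}_n(S)|z^n$ (the empty matching counts for $n=0$). The juxtaposition of $\alpha,\beta$ is the word of $\alpha$ followed by the word of $\beta$ with $|\alpha|$ added to each letter; a matching is connected if it is nonempty and is not the juxtaposition of two nonempty matchings. $1(\sigma+1)1$ (the lifting of $\sigma$) is the word consisting of the letter $1$, then the word of $\sigma$ with $1$ added to each letter, then $1$. $C(z)=\sum_{n\ge0}\frac{1}{n+1}\binom{2n}{n}z^n$. -}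

module Defs where

open import Data.Nat using (ℕ; zero; suc; _∸_; ⌊_/2⌋) renaming (_+_ to _+ⁿ_; _*_ to _*ⁿ_; _/_ to _/ⁿ_)
open import Data.Nat.Properties using (_≟_; suc-injective)
open import Data.Nat.Combinatorics using (_C_)
open import Data.Integer using (ℤ; +_; _+_; _*_; _-_; 0ℤ; 1ℤ)
open import Data.Fin as Fin using (Fin)
import Data.Fin.Properties as Fin
open import Data.List using (List; []; _∷_; _++_; [_]; map; length; lookup; filter; upTo; deduplicate; cartesianProductWith)
open import Data.List.Membership.Propositional using (_∈_)
open import Data.List.Membership.Propositional.Properties using (∈-cartesianProductWith⁺; ∈-filter⁺; ∈-filter⁻; ∈-deduplicate⁺)
open import Data.List.Properties using (≡-dec; ∷-injective)
open import Data.List.Relation.Unary.All as All using (All; []; _∷_)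
open import Data.List.Relation.Unary.AllPairs using ([]; _∷_)
open import Data.List.Relation.Unary.Unique.Propositional using (Unique)
import Data.List.Relation.Unary.Unique.Propositional.Properties as Unique
open import Data.List.Relation.Unary.Any using (here)
open import Data.Product using (_×_; _,_; ∃; ∃-syntax; proj₂)
open import Data.Vec as Vec using (Vec; []; _∷_)
open import Relation.Binary.PropositionalEquality using (_≡_; _≢_; refl; subst)
open import Relation.Nullary using (¬_; Dec)
open import Relation.Nullary.Decidable using (map′; ¬?; _×-dec_; _→-dec_)
open import Relation.Unary using (Decidable)

Word : Set
Word = List ℕ

letters : ℕ → List ℕ
letters n = map suc (upTo n)

OccursTwice : Word → ℕ → Set
OccursTwice w a = length (filter (a ≟_) w) ≡ 2

-- `deduplicate` keeps the first occurrence of each letter, so the last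
-- condition says that the left vertices, read from left to right, carry the
-- letters 1, …, n in this order.
IsMatching : ℕ → Word → Set
IsMatching n w = length w ≡ 2 *ⁿ n
               × All (OccursTwice w) (letters n)
               × deduplicate _≟_ w ≡ letters n

isMatching? : ∀ n → Decidable (IsMatching n)
isMatching? n w = (length w ≟ 2 *ⁿ n)
            ×-dec All.all? (λ a → length (filter (a ≟_) w) ≟ 2) (letters n)
            ×-dec ≡-dec _≟_ (deduplicate _≟_ w) (letters n)

order : Word → ℕ
order w = ⌊ length w /2⌋

juxtapose : Word → Word → Word
juxtapose α β = α ++ map (order α +ⁿ_) β

Connected : Word → Set
Connected w = w ≢ []
            × ¬ (∃[ a ] ∃[ b ] ∃[ α ] ∃[ β ]
                   IsMatching a α × IsMatching b β
                   × α ≢ [] × β ≢ [] × w ≡ juxtapose α β)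

lifting : Word → Word
lifting w = 1 ∷ map suc w ++ [ 1 ]

χ χ̄ : Word
χ = 1 ∷ 2 ∷ 3 ∷ 1 ∷ 3 ∷ 2 ∷ []
χ̄ = 1 ∷ 2 ∷ 3 ∷ 2 ∷ 1 ∷ 3 ∷ []

-- The pair {i , j} of positions is an edge of the matching with word w.
Edge : (w : Word) → Fin (length w) → Fin (length w) → Set
Edge w i j = i ≢ j × lookup w i ≡ lookup w j

edge? : ∀ w i j → Dec (Edge w i j)
edge? w i j = ¬? (i Fin.≟ j) ×-dec (lookup w i ≟ lookup w j)

StrictlyIncreasing : ∀ {m k} → Vec (Fin m) k → Set
StrictlyIncreasing is = ∀ p q → p Fin.< q → Vec.lookup is p Fin.< Vec.lookup is q

IsOccurrence : (σ τ : Word) → Vec (Fin (length τ)) (length σ) → Set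
IsOccurrence σ τ is =
  StrictlyIncreasing is
  × (∀ p q → (Edge τ (Vec.lookup is p) (Vec.lookup is q) → Edge σ p q)
           × (Edge σ p q → Edge τ (Vec.lookup is p) (Vec.lookup is q)))

_IsPatternOf_ : Word → Word → Set
σ IsPatternOf τ = ∃ (IsOccurrence σ τ)

_Avoids_ : Word → Word → Set
τ Avoids σ = ¬ (σ IsPatternOf τ)

anyVec? : ∀ {m k} {P : Vec (Fin m) k → Set} → Decidable P → Dec (∃ P)
anyVec? {k = zero}  P? = map′ ([] ,_) (λ { ([] , p) → p }) (P? [])
anyVec? {k = suc k} P? =
  map′ (λ { (i , is , p) → i ∷ is , p }) (λ { (i ∷ is , p) → i , is , p })
       (Fin.any? λ i → anyVec? λ is → P? (i ∷ is))

isOccurrence? : ∀ σ τ → Decidable (IsOccurrence σ τ)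
isOccurrence? σ τ is =
  Fin.all? (λ p → Fin.all? λ q → (p Fin.<? q) →-dec (Vec.lookup is p Fin.<? Vec.lookup is q))
  ×-dec
  Fin.all? (λ p → Fin.all? λ q →
    (edge? τ (Vec.lookup is p) (Vec.lookup is q) →-dec edge? σ p q)
    ×-dec (edge? σ p q →-dec edge? τ (Vec.lookup is p) (Vec.lookup is q)))

avoids? : ∀ τ → Decidable (τ Avoids_)
avoids? τ σ = ¬? (anyVec? (isOccurrence? σ τ))

AvoidingMatching : List Word → ℕ → Word → Set
AvoidingMatching S n w = IsMatching n w × All (w Avoids_) S

avoidingMatching? : ∀ S n → Decidable (AvoidingMatching S n)
avoidingMatching? S n w = isMatching? n w ×-dec All.all? (avoids? w) S

words : List ℕ → ℕ → List Word
words as zero    = [ [] ]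
words as (suc l) = cartesianProductWith _∷_ as (words as l)

𝓜 : List Word → ℕ → List Word
𝓜 S n = filter (avoidingMatching? S n) (words (letters n) (2 *ⁿ n))

words-unique : ∀ {as} → Unique as → ∀ l → Unique (words as l)
words-unique u zero    = [] ∷ []
words-unique u (suc l) = Unique.cartesianProductWith⁺ _∷_ ∷-injective u (words-unique u l)

∈-words : ∀ {as} w → All (_∈ as) w → w ∈ words as (length w)
∈-words []      []       = here refl
∈-words (a ∷ w) (p ∷ ps) = ∈-cartesianProductWith⁺ _∷_ p (∈-words w ps)

-- The next three facts show that length (𝓜 S n) is the number of matchings
-- of order n avoiding S.
𝓜-unique : ∀ S n → Unique (𝓜 S n)
𝓜-unique S n = Unique.filter⁺ (avoidingMatching? S n)
  (words-unique (Unique.map⁺ suc-injective (Unique.upTo⁺ n)) (2 *ⁿ n))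

𝓜-sound : ∀ S n {w} → w ∈ 𝓜 S n → AvoidingMatching S n w
𝓜-sound S n w∈ = proj₂ (∈-filter⁻ (avoidingMatching? S n) {xs = words (letters n) (2 *ⁿ n)} w∈)

𝓜-complete : ∀ S n {w} → AvoidingMatching S n w → w ∈ 𝓜 S n
𝓜-complete S n {w} m@((len , _ , dedup) , _) =
  ∈-filter⁺ (avoidingMatching? S n)
    (subst (λ l → w ∈ words (letters n) l) len
      (∈-words w (All.tabulate λ {a} a∈w → subst (a ∈_) dedup (∈-deduplicate⁺ _≟_ a∈w))))
    m

-- Formal power series over ℤ, given by their coefficients.
Series : Set
Series = ℕ → ℤ

infix  4 _≈_ _≈1/_
infixl 6 _-ˢ_
infixl 7 _*ˢ_
infixr 8 _^ˢ_

_≈_ : Series → Series → Set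
A ≈ B = ∀ n → A n ≡ B n

∑≤ : ℕ → (ℕ → ℤ) → ℤ
∑≤ zero    f = f 0
∑≤ (suc n) f = ∑≤ n f + f (suc n)

1ˢ : Series
1ˢ zero    = 1ℤ
1ˢ (suc _) = 0ℤ

z : Series
z 1 = 1ℤ
z _ = 0ℤ

_-ˢ_ : Series → Series → Series
(A -ˢ B) n = A n - B n

_*ˢ_ : Series → Series → Series
(A *ˢ B) n = ∑≤ n λ i → A i * B (n ∸ i)

_^ˢ_ : Series → ℕ → Series
A ^ˢ zero  = 1ˢ
A ^ˢ suc k = A *ˢ (A ^ˢ k)

-- A(B(z)), for B with zero constant term: then B^k has no term of degree
-- below k, so only the powers k ≤ n contribute to the coefficient of z^n.
_⟨_⟩ : Series → Series → Series
(A ⟨ B ⟩) n = ∑≤ n λ k → A k * (B ^ˢ k) n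

-- A = 1/B in the ring of formal power series.
_≈1/_ : Series → Series → Set
A ≈1/ B = A *ˢ B ≈ 1ˢ

-- The division is exact.
catalan : Series
catalan n = + (((2 *ⁿ n) C n) /ⁿ suc n)

𝓜[_] : List Word → Series
𝓜[ S ] n = + length (𝓜 S n)

{-# OPTIONS --safe #-}
module Submission where

-- In a matching avoiding χ and χ̄ no edge crosses both edges of a nested pair.
-- Hence the edges that are nested in no other edge (the outer edges) are
-- pairwise non-nested, and every other edge lies in one of the gaps between
-- consecutive vertices of outer edges. Since σ is connected, lifting σ is
-- avoided exactly if every gap below an outer edge holds a matching avoiding
-- σ, χ and χ̄.
--
-- Read from left to right, such a matching is a sequence of insertions into a
-- first-in first-out queue of open outer edges and of removals from it, where
-- each step at a nonempty queue is preceded by the content of a gap. If Fₕ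
-- counts the possible continuations at a queue of length h, then F₀ = 1 + z F₁
-- and Fₕ₊₁ = M (Fₕ + z Fₕ₊₂). With Rₕ = Mʰ C(z M²)ʰ, whose coefficients are
-- given by ballot numbers, Fₕ = F₀ Rₕ solves the second family of equations,
-- and the first one becomes F₀ = 1 + z F₀ R₁.

-- An edge that begins at an empty queue lies below no open edge and is therefore outer itself. So
-- gaps exist only at positive height, and F₀ is the series sought. It is treated as an unknown
-- boundary value: the equations at positive height are verified for F₀ Rₕ by induction on the
-- letters left to read, and the first edge of a nonempty matching supplies the one remaining
-- equation. In Rₕ each insertion is paired with the removal that undoes it; both are preceded by a
-- gap, whence z M², and the h unpaired removals give Mʰ.
--
-- The delicate direction is that filling a gap creates no forbidden pattern. The letters filled in
-- occur nowhere else, so the part of an occurrence that falls into the gap is a factor closed under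
-- taking partners. χ and χ̄ have no such factor that is proper and nonempty. The lifting of σ may
-- have some strictly inside σ; to use one, an occurrence would need nested outer edges or a cut of
-- σ into two separate parts. The order of the queue excludes the former, connectedness the latter.

open import Defs
open import Algebra.Bundles using (CommutativeSemiring)
import Algebra.Solver.Ring.NaturalCoefficients.Default as SemiringSolver
open import Algebra.Structures.Biased using (IsCommutativeSemiringˡ)
open import Data.Empty using (⊥; ⊥-elim)
open import Data.Fin as Fin using (Fin; zero; suc; toℕ; fromℕ<)
import Data.Fin.Properties as Fin
open import Data.Integer using (ℤ; +_; _+_; _*_; _-_; 0ℤ; 1ℤ)
import Data.Integer.Properties as ℤ
import Data.Integer.Tactic.RingSolver as ℤ
open import Data.List using (List; []; _∷_; _++_; [_]; map; length; filter; applyUpTo; deduplicate; take; drop)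
import Data.List as List
open import Data.List.Membership.Propositional using (_∈_; _∉_)
open import Data.List.Membership.Propositional.Properties using (∈-map⁺; ∈-map⁻; ∈-++⁺ˡ; ∈-++⁺ʳ; ∈-++⁻; ∈-∃++; ∈-filter⁺; ∈-deduplicate⁺; ∈-deduplicate⁻; ∈-length; ∈-lookup)
open import Data.List.Membership.Propositional.Properties.WithK using (unique∧set⇒bag)
open import Data.List.Properties using (≡-dec; length-map; length-++; length-++-≤ˡ; length-++-≤ʳ; filter-++; filter-accept; filter-reject; filter-all; filter-none; ∷-injective; ∷-injectiveˡ; ∷-injectiveʳ; ++-assoc; ++-identityʳ; ++-cancelˡ; map-++; map-∘; map-id-local; map-injective; map-cong-local)
open import Data.List.Relation.Binary.BagAndSetEquality using (∼bag⇒↭)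
open import Data.List.Relation.Binary.Permutation.Propositional.Properties using (↭-length)
open import Data.List.Relation.Binary.Sublist.Propositional using (_⊆_; []; _∷_; _∷ʳ_; ⊆-refl; ⊆-trans; minimum; from∈; to∈; lookup)
import Data.List.Relation.Binary.Sublist.Propositional.Properties as ⊆
open import Data.List.Relation.Unary.All as All using (All; []; _∷_)
open import Data.List.Relation.Unary.AllPairs using ([]; _∷_)
open import Data.List.Relation.Unary.Any as Any using (here; there)
import Data.List.Relation.Unary.Any.Properties as Any
open import Data.List.Relation.Unary.Unique.Propositional using (Unique)
import Data.List.Relation.Unary.Unique.Propositional.Properties as Unique
open import Data.Nat using (ℕ; zero; suc; _∸_; _≤_; _<_; z≤n; s≤s; _≟_; _<?_; _≤?_; ⌊_/2⌋) renaming (_+_ to _+ⁿ_; _*_ to _*ⁿ_; _/_ to _/ⁿ_)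
open import Data.Nat.Combinatorics using (_C_; nCn≡1; nC1≡n; nCk≡nC[n∸k]; nCk+nC[k+1]≡[n+1]C[k+1])
open import Data.Nat.Combinatorics.Specification using (k>n⇒nCk≡0)
open import Data.Nat.DivMod using (m*n/n≡m)
import Data.Nat.Properties as ℕ
import Data.Nat.Tactic.RingSolver as ℕ
open import Data.Product using (_×_; _,_; ∃-syntax; proj₁; proj₂)
open import Data.Sum using (_⊎_; inj₁; inj₂; [_,_]′)
open import Data.Unit using (tt)
open import Data.Vec as Vec using (Vec; []; _∷_)
import Data.Vec.Properties as Vec
open import Function.Bundles using (mk⇔)
open import Level using (0ℓ)
open import Relation.Binary.Definitions using (tri<; tri≈; tri>)
open import Relation.Binary.PropositionalEquality using (_≡_; _≢_; refl; sym; trans; cong; cong₂; subst; subst₂; module ≡-Reasoning)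
open import Relation.Binary.Structures using (IsEquivalence)
open import Relation.Nullary using (¬_; yes; no)
open import Relation.Nullary.Decidable using (toWitness; ¬?; _→-dec_; _×-dec_; _⊎-dec_)
open import Relation.Unary using (Decidable)
open import Algebra.Properties.AbelianGroup ℤ.+-0-abelianGroup using (∙-cancelʳ)
open import Data.List.Membership.DecPropositional _≟_ using (_∈?_)

open ≡-Reasoning

-- Formal power series

∑≤-cong : ∀ n {f g : ℕ → ℤ} → (∀ i → i ≤ n → f i ≡ g i) → ∑≤ n f ≡ ∑≤ n g
∑≤-cong zero    eq = eq 0 z≤n
∑≤-cong (suc n) eq = cong₂ _+_ (∑≤-cong n λ i i≤n → eq i (ℕ.m≤n⇒m≤1+n i≤n)) (eq (suc n) ℕ.≤-refl)

∑≤-zero : ∀ n {f : ℕ → ℤ} → (∀ i → i ≤ n → f i ≡ 0ℤ) → ∑≤ n f ≡ 0ℤ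
∑≤-zero zero    eq = eq 0 z≤n
∑≤-zero (suc n) eq = cong₂ _+_ (∑≤-zero n λ i i≤n → eq i (ℕ.m≤n⇒m≤1+n i≤n)) (eq (suc n) ℕ.≤-refl)

∑≤-suc : ∀ n (f : ℕ → ℤ) → ∑≤ (suc n) f ≡ f 0 + ∑≤ n (λ i → f (suc i))
∑≤-suc zero    f = refl
∑≤-suc (suc n) f = begin
  ∑≤ (suc n) f + f (suc (suc n))                        ≡⟨ cong (_+ f (suc (suc n))) (∑≤-suc n f) ⟩
  f 0 + ∑≤ n (λ i → f (suc i)) + f (suc (suc n))        ≡⟨ ℤ.+-assoc (f 0) _ _ ⟩
  f 0 + (∑≤ n (λ i → f (suc i)) + f (suc (suc n)))      ∎

∑≤-+ : ∀ n (f g : ℕ → ℤ) → ∑≤ n (λ i → f i + g i) ≡ ∑≤ n f + ∑≤ n g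
∑≤-+ zero    f g = refl
∑≤-+ (suc n) f g = begin
  ∑≤ n (λ i → f i + g i) + (f (suc n) + g (suc n))  ≡⟨ cong (_+ (f (suc n) + g (suc n))) (∑≤-+ n f g) ⟩
  ∑≤ n f + ∑≤ n g + (f (suc n) + g (suc n))         ≡⟨ interchange (∑≤ n f) (∑≤ n g) (f (suc n)) (g (suc n)) ⟩
  ∑≤ n f + f (suc n) + (∑≤ n g + g (suc n))         ∎
  where
  interchange : ∀ a b c d → a + b + (c + d) ≡ a + c + (b + d)
  interchange = ℤ.solve-∀

∑≤-*ˡ : ∀ n (c : ℤ) (f : ℕ → ℤ) → ∑≤ n (λ i → c * f i) ≡ c * ∑≤ n f
∑≤-*ˡ zero    c f = refl
∑≤-*ˡ (suc n) c f = begin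
  ∑≤ n (λ i → c * f i) + c * f (suc n)  ≡⟨ cong (_+ c * f (suc n)) (∑≤-*ˡ n c f) ⟩
  c * ∑≤ n f + c * f (suc n)            ≡⟨ sym (ℤ.*-distribˡ-+ c _ _) ⟩
  c * (∑≤ n f + f (suc n))              ∎

∑≤-reverse : ∀ n (f : ℕ → ℤ) → ∑≤ n f ≡ ∑≤ n (λ i → f (n ∸ i))
∑≤-reverse zero    f = refl
∑≤-reverse (suc n) f = begin
  ∑≤ n f + f (suc n)                      ≡⟨ cong (_+ f (suc n)) (∑≤-reverse n f) ⟩
  ∑≤ n (λ i → f (n ∸ i)) + f (suc n)      ≡⟨ ℤ.+-comm _ (f (suc n)) ⟩
  f (suc n) + ∑≤ n (λ i → f (n ∸ i))      ≡⟨ sym (∑≤-suc n (λ i → f (suc n ∸ i))) ⟩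
  ∑≤ (suc n) (λ i → f (suc n ∸ i))        ∎

infixl 6 _+ˢ_

_+ˢ_ : Series → Series → Series
(A +ˢ B) n = A n + B n

0ˢ : Series
0ˢ _ = 0ℤ

tail : Series → Series
tail A n = A (suc n)

-- Peeling off the constant term of the left factor turns identities of products into inductions on
-- the degree; associativity then needs no reindexing of a triangular double sum.
*ˢ-suc : ∀ A B n → (A *ˢ B) (suc n) ≡ A 0 * B (suc n) + (tail A *ˢ B) n
*ˢ-suc A B n = ∑≤-suc n (λ i → A i * B (suc n ∸ i))

*ˢ-cong : ∀ {A A′ B B′} → A ≈ A′ → B ≈ B′ → A *ˢ B ≈ A′ *ˢ B′
*ˢ-cong A≈ B≈ n = ∑≤-cong n λ i _ → cong₂ _*_ (A≈ i) (B≈ (n ∸ i))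

*ˢ-comm : ∀ A B → A *ˢ B ≈ B *ˢ A
*ˢ-comm A B n = begin
  ∑≤ n (λ i → A i * B (n ∸ i))              ≡⟨ ∑≤-reverse n (λ i → A i * B (n ∸ i)) ⟩
  ∑≤ n (λ i → A (n ∸ i) * B (n ∸ (n ∸ i)))  ≡⟨ ∑≤-cong n (λ i i≤n →
      trans (cong (λ j → A (n ∸ i) * B j) (ℕ.m∸[m∸n]≡n i≤n)) (ℤ.*-comm (A (n ∸ i)) (B i))) ⟩
  ∑≤ n (λ i → B i * A (n ∸ i))              ∎

*ˢ-distribʳ : ∀ D A B → (A +ˢ B) *ˢ D ≈ A *ˢ D +ˢ B *ˢ D
*ˢ-distribʳ D A B n = trans
  (∑≤-cong n λ i _ → ℤ.*-distribʳ-+ (D (n ∸ i)) (A i) (B i))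
  (∑≤-+ n (λ i → A i * D (n ∸ i)) (λ i → B i * D (n ∸ i)))

*ˢ-scaleˡ : ∀ c A B → (λ n → c * A n) *ˢ B ≈ λ n → c * (A *ˢ B) n
*ˢ-scaleˡ c A B n = trans
  (∑≤-cong n λ i _ → ℤ.*-assoc c (A i) (B (n ∸ i)))
  (∑≤-*ˡ n c λ i → A i * B (n ∸ i))

*ˢ-assoc : ∀ A B D → (A *ˢ B) *ˢ D ≈ A *ˢ (B *ˢ D)
*ˢ-assoc A B D zero    = ℤ.*-assoc (A 0) (B 0) (D 0)
*ˢ-assoc A B D (suc n) = begin
  ((A *ˢ B) *ˢ D) (suc n)
    ≡⟨ *ˢ-suc (A *ˢ B) D n ⟩
  A 0 * B 0 * D (suc n) + (tail (A *ˢ B) *ˢ D) n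
    ≡⟨ cong (_+_ (A 0 * B 0 * D (suc n))) (*ˢ-cong {B = D} (*ˢ-suc A B) (λ _ → refl) n) ⟩
  A 0 * B 0 * D (suc n) + (((λ m → A 0 * tail B m) +ˢ tail A *ˢ B) *ˢ D) n
    ≡⟨ cong (_+_ (A 0 * B 0 * D (suc n))) (*ˢ-distribʳ D (λ m → A 0 * tail B m) (tail A *ˢ B) n) ⟩
  A 0 * B 0 * D (suc n) + (((λ m → A 0 * tail B m) *ˢ D) n + ((tail A *ˢ B) *ˢ D) n)
    ≡⟨ cong₂ (λ x y → A 0 * B 0 * D (suc n) + (x + y)) (*ˢ-scaleˡ (A 0) (tail B) D n) (*ˢ-assoc (tail A) B D n) ⟩
  A 0 * B 0 * D (suc n) + (A 0 * (tail B *ˢ D) n + (tail A *ˢ (B *ˢ D)) n)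
    ≡⟨ regroup (A 0) (B 0) (D (suc n)) _ _ ⟩
  A 0 * (B 0 * D (suc n) + (tail B *ˢ D) n) + (tail A *ˢ (B *ˢ D)) n
    ≡⟨ cong (λ x → A 0 * x + (tail A *ˢ (B *ˢ D)) n) (sym (*ˢ-suc B D n)) ⟩
  A 0 * (B *ˢ D) (suc n) + (tail A *ˢ (B *ˢ D)) n
    ≡⟨ sym (*ˢ-suc A (B *ˢ D) n) ⟩
  (A *ˢ (B *ˢ D)) (suc n) ∎
  where
  regroup : ∀ a b c d e → a * b * c + (a * d + e) ≡ a * (b * c + d) + e
  regroup = ℤ.solve-∀

0ˢ-*ˢ : ∀ A → 0ˢ *ˢ A ≈ 0ˢ
0ˢ-*ˢ A n = ∑≤-zero n λ i _ → ℤ.*-zeroˡ (A (n ∸ i))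

*ˢ-identityˡ : ∀ A → 1ˢ *ˢ A ≈ A
*ˢ-identityˡ A zero    = ℤ.*-identityˡ (A 0)
*ˢ-identityˡ A (suc n) = begin
  (1ˢ *ˢ A) (suc n)               ≡⟨ *ˢ-suc 1ˢ A n ⟩
  1ℤ * A (suc n) + (0ˢ *ˢ A) n    ≡⟨ cong₂ _+_ (ℤ.*-identityˡ (A (suc n))) (0ˢ-*ˢ A n) ⟩
  A (suc n) + 0ℤ                  ≡⟨ ℤ.+-identityʳ _ ⟩
  A (suc n)                       ∎

z*ˢ-suc : ∀ A n → (z *ˢ A) (suc n) ≡ A n
z*ˢ-suc A n = begin
  (z *ˢ A) (suc n)                   ≡⟨ *ˢ-suc z A n ⟩
  0ℤ * A (suc n) + (tail z *ˢ A) n   ≡⟨ cong₂ _+_ (ℤ.*-zeroˡ (A (suc n))) (*ˢ-cong {B = A} tail-z (λ _ → refl) n) ⟩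
  0ℤ + (1ˢ *ˢ A) n                   ≡⟨ ℤ.+-identityˡ _ ⟩
  (1ˢ *ˢ A) n                        ≡⟨ *ˢ-identityˡ A n ⟩
  A n                                ∎
  where
  tail-z : tail z ≈ 1ˢ
  tail-z zero    = refl
  tail-z (suc _) = refl

≈-isEquivalence : IsEquivalence _≈_
≈-isEquivalence = record
  { refl  = λ _ → refl
  ; sym   = λ A≈B n → sym (A≈B n)
  ; trans = λ A≈B B≈D n → trans (A≈B n) (B≈D n)
  }

Series-commutativeSemiring : CommutativeSemiring 0ℓ 0ℓ
Series-commutativeSemiring = record
  { _+_ = _+ˢ_
  ; _*_ = _*ˢ_
  ; 0#  = 0ˢ
  ; 1#  = 1ˢ
  ; isCommutativeSemiring = IsCommutativeSemiringˡ.isCommutativeSemiring (record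
    { +-isCommutativeMonoid = record
      { isMonoid = record
        { isSemigroup = record
          { isMagma = record
            { isEquivalence = ≈-isEquivalence
            ; ∙-cong        = λ A≈ B≈ n → cong₂ _+_ (A≈ n) (B≈ n)
            }
          ; assoc = λ A B D n → ℤ.+-assoc (A n) (B n) (D n)
          }
        ; identity = (λ A n → ℤ.+-identityˡ (A n)) , (λ A n → ℤ.+-identityʳ (A n))
        }
      ; comm = λ A B n → ℤ.+-comm (A n) (B n)
      }
    ; *-isCommutativeMonoid = record
      { isMonoid = record
        { isSemigroup = record
          { isMagma = record
            { isEquivalence = ≈-isEquivalence
            ; ∙-cong        = *ˢ-cong
            }
          ; assoc = *ˢ-assoc
          }
        ; identity = *ˢ-identityˡ , (λ A n → trans (*ˢ-comm A 1ˢ n) (*ˢ-identityˡ A n))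
        }
      ; comm = *ˢ-comm
      }
    ; distribʳ = *ˢ-distribʳ
    ; zeroˡ    = 0ˢ-*ˢ
    })
  }

open CommutativeSemiring Series-commutativeSemiring using ()
  renaming (refl to ≈-refl; sym to ≈-sym; trans to ≈-trans; +-cong to +ˢ-cong)
open SemiringSolver Series-commutativeSemiring using (solve; con; _:+_; _:*_; _:=_)

-- Composition of power series

^ˢ-lowOrder : ∀ {X} → X 0 ≡ 0ℤ → ∀ k n → n < k → (X ^ˢ k) n ≡ 0ℤ
^ˢ-lowOrder {X} X₀ (suc k) n (s≤s n≤k) = ∑≤-zero n term
  where
  term : ∀ i → i ≤ n → X i * (X ^ˢ k) (n ∸ i) ≡ 0ℤ
  term zero    _   = trans (cong (_* (X ^ˢ k) n) X₀) (ℤ.*-zeroˡ ((X ^ˢ k) n))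
  term (suc i) i<n = trans
    (cong (X (suc i) *_) (^ˢ-lowOrder {X} X₀ k (n ∸ suc i)
      (ℕ.<-≤-trans (ℕ.∸-monoʳ-< (s≤s z≤n) i<n) n≤k)))
    (ℤ.*-zeroʳ (X (suc i)))

⟨⟩-cong : ∀ {A B} X → A ≈ B → A ⟨ X ⟩ ≈ B ⟨ X ⟩
⟨⟩-cong X A≈B n = ∑≤-cong n λ k _ → cong (_* (X ^ˢ k) n) (A≈B k)

⟨⟩-constant : ∀ {A} X → tail A ≈ 0ˢ → A ⟨ X ⟩ ≈ λ n → A 0 * 1ˢ n
⟨⟩-constant {A} X tailA zero    = refl
⟨⟩-constant {A} X tailA (suc n) = begin
  (A ⟨ X ⟩) (suc n)
    ≡⟨ ∑≤-suc n (λ k → A k * (X ^ˢ k) (suc n)) ⟩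
  A 0 * 0ℤ + ∑≤ n (λ k → A (suc k) * (X ^ˢ suc k) (suc n))
    ≡⟨ cong (_+_ (A 0 * 0ℤ)) (∑≤-zero n λ k _ →
         trans (cong (_* (X ^ˢ suc k) (suc n)) (tailA k)) (ℤ.*-zeroˡ ((X ^ˢ suc k) (suc n)))) ⟩
  A 0 * 0ℤ + 0ℤ
    ≡⟨ ℤ.+-identityʳ _ ⟩
  A 0 * 0ℤ ∎

-- Composition stops at k = n, a limit that varies with the coefficient. The terms beyond it vanish,
-- so inside a product all limits can be made equal before the sums are interchanged.
⟨⟩-extend : ∀ A {X} → X 0 ≡ 0ℤ → ∀ d n → ∑≤ (d +ⁿ n) (λ k → A k * (X ^ˢ k) n) ≡ (A ⟨ X ⟩) n
⟨⟩-extend A     X₀ zero    n = refl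
⟨⟩-extend A {X} X₀ (suc d) n = begin
  ∑≤ (d +ⁿ n) f + f (suc d +ⁿ n)
    ≡⟨ cong₂ _+_ (⟨⟩-extend A {X} X₀ d n) (trans
         (cong (A (suc d +ⁿ n) *_) (^ˢ-lowOrder {X} X₀ (suc d +ⁿ n) n (s≤s (ℕ.m≤n+m n d))))
         (ℤ.*-zeroʳ (A (suc d +ⁿ n)))) ⟩
  (A ⟨ X ⟩) n + 0ℤ
    ≡⟨ ℤ.+-identityʳ _ ⟩
  (A ⟨ X ⟩) n ∎
  where
  f : ℕ → ℤ
  f k = A k * (X ^ˢ k) n

∑≤-swap : ∀ n m (f : ℕ → ℕ → ℤ) → ∑≤ n (λ i → ∑≤ m (f i)) ≡ ∑≤ m (λ j → ∑≤ n (λ i → f i j))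
∑≤-swap zero    m f = refl
∑≤-swap (suc n) m f = begin
  ∑≤ n (λ i → ∑≤ m (f i)) + ∑≤ m (f (suc n))                ≡⟨ cong (_+ ∑≤ m (f (suc n))) (∑≤-swap n m f) ⟩
  ∑≤ m (λ j → ∑≤ n (λ i → f i j)) + ∑≤ m (f (suc n))        ≡⟨ sym (∑≤-+ m (λ j → ∑≤ n (λ i → f i j)) (f (suc n))) ⟩
  ∑≤ m (λ j → ∑≤ n (λ i → f i j) + f (suc n) j)             ∎

*ˢ-⟨⟩ : ∀ A {X} → X 0 ≡ 0ℤ → ∀ n →
  (X *ˢ (A ⟨ X ⟩)) n ≡ ∑≤ n (λ k → A k * (X ^ˢ suc k) n)
*ˢ-⟨⟩ A {X} X₀ n = begin
  ∑≤ n (λ i → X i * (A ⟨ X ⟩) (n ∸ i))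
    ≡⟨ ∑≤-cong n (λ i i≤n → cong (X i *_) (trans (sym (⟨⟩-extend A {X} X₀ i (n ∸ i)))
         (cong (λ N → ∑≤ N (λ k → A k * (X ^ˢ k) (n ∸ i))) (ℕ.m+[n∸m]≡n i≤n)))) ⟩
  ∑≤ n (λ i → X i * ∑≤ n (λ k → A k * (X ^ˢ k) (n ∸ i)))
    ≡⟨ ∑≤-cong n (λ i _ → sym (∑≤-*ˡ n (X i) (λ k → A k * (X ^ˢ k) (n ∸ i)))) ⟩
  ∑≤ n (λ i → ∑≤ n (λ k → X i * (A k * (X ^ˢ k) (n ∸ i))))
    ≡⟨ ∑≤-swap n n (λ i k → X i * (A k * (X ^ˢ k) (n ∸ i))) ⟩
  ∑≤ n (λ k → ∑≤ n (λ i → X i * (A k * (X ^ˢ k) (n ∸ i))))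
    ≡⟨ ∑≤-cong n (λ k _ → trans (∑≤-cong n λ i _ → left-comm (X i) (A k) _) (∑≤-*ˡ n (A k) _)) ⟩
  ∑≤ n (λ k → A k * (X ^ˢ suc k) n) ∎
  where
  left-comm : ∀ a b c → a * (b * c) ≡ b * (a * c)
  left-comm = ℤ.solve-∀

-- This substitutes X for x in A(x) = B(x) + x D(x). The ballot recurrence has this shape: C^(h+1) =
-- C^h + x C^(h+2), which is C = 1 + x C² multiplied by C^h.
⟨⟩-shift : ∀ A B D X → X 0 ≡ 0ℤ → A 0 ≡ B 0 → (∀ k → A (suc k) ≡ B (suc k) + D k) →
  A ⟨ X ⟩ ≈ B ⟨ X ⟩ +ˢ X *ˢ (D ⟨ X ⟩)
⟨⟩-shift A B D X X₀ A₀ A₊ zero    = begin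
  A 0 * 1ℤ                       ≡⟨ cong (_* 1ℤ) A₀ ⟩
  B 0 * 1ℤ                       ≡⟨ sym (ℤ.+-identityʳ _) ⟩
  B 0 * 1ℤ + 0ℤ                  ≡⟨ cong (_+_ (B 0 * 1ℤ)) (sym (trans (cong (_* (D 0 * 1ℤ)) X₀) (ℤ.*-zeroˡ (D 0 * 1ℤ)))) ⟩
  B 0 * 1ℤ + X 0 * (D 0 * 1ℤ)    ∎
⟨⟩-shift A B D X X₀ A₀ A₊ (suc n) = begin
  (A ⟨ X ⟩) (suc n)
    ≡⟨ ∑≤-suc n (λ k → A k * (X ^ˢ k) (suc n)) ⟩
  A 0 * 0ℤ + ∑≤ n (λ k → A (suc k) * p k)
    ≡⟨ cong₂ _+_ (cong (_* 0ℤ) A₀) (trans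
         (∑≤-cong n λ k _ → trans (cong (_* p k) (A₊ k)) (ℤ.*-distribʳ-+ (p k) (B (suc k)) (D k)))
         (∑≤-+ n (λ k → B (suc k) * p k) (λ k → D k * p k))) ⟩
  B 0 * 0ℤ + (∑≤ n (λ k → B (suc k) * p k) + ∑≤ n (λ k → D k * p k))
    ≡⟨ sym (ℤ.+-assoc (B 0 * 0ℤ) _ _) ⟩
  B 0 * 0ℤ + ∑≤ n (λ k → B (suc k) * p k) + ∑≤ n (λ k → D k * p k)
    ≡⟨ cong₂ _+_ (sym (∑≤-suc n (λ k → B k * (X ^ˢ k) (suc n)))) (sym last-vanishes) ⟩
  (B ⟨ X ⟩) (suc n) + ∑≤ (suc n) (λ k → D k * p k)
    ≡⟨ cong (_+_ ((B ⟨ X ⟩) (suc n))) (sym (*ˢ-⟨⟩ D {X} X₀ (suc n))) ⟩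
  (B ⟨ X ⟩) (suc n) + (X *ˢ (D ⟨ X ⟩)) (suc n) ∎
  where
  p : ℕ → ℤ
  p k = (X ^ˢ suc k) (suc n)
  -- The product with X is summed up to `suc n`, whereas splitting off k = 0 leaves a sum up to n.
  -- The surplus power X^(n+2) has no term in degree n + 1.
  last-vanishes : ∑≤ (suc n) (λ k → D k * p k) ≡ ∑≤ n (λ k → D k * p k)
  last-vanishes = trans
    (cong (_+_ (∑≤ n (λ k → D k * p k))) (trans
      (cong (D (suc n) *_) (^ˢ-lowOrder {X} X₀ (suc (suc n)) (suc n) ℕ.≤-refl)) (ℤ.*-zeroʳ (D (suc n)))))
    (ℤ.+-identityʳ _)

-- Ballot numbers

-- ballot h k is the coefficient of x^k in C(x)^h.
ballot : ℕ → ℕ → ℕ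
ballot zero    zero    = 1
ballot zero    (suc k) = 0
ballot (suc h) zero    = 1
ballot (suc h) (suc k) = ballot h (suc k) +ⁿ ballot (2 +ⁿ h) k

nC0≡1 : ∀ n → n C 0 ≡ 1
nC0≡1 n = trans (nCk≡nC[n∸k] {0} {n} z≤n) (nCn≡1 n)

-- Reflection principle: a ballot number is the difference of two adjacent binomial coefficients,
-- written as a sum to stay in ℕ. Pascal's rule matches the recurrence of `ballot`.
ballot-C : ∀ h k → let n = 2 +ⁿ (k +ⁿ k +ⁿ h) in ballot (suc h) (suc k) +ⁿ n C k ≡ n C suc k
ballot-C zero zero = refl
ballot-C zero (suc k) = begin
  b +ⁿ (3 +ⁿ (k +ⁿ suc k +ⁿ 0)) C suc k   ≡⟨ cong (λ m → b +ⁿ (3 +ⁿ m) C suc k) index ⟩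
  b +ⁿ suc n C suc k                      ≡⟨ cong (b +ⁿ_) (sym (nCk+nC[k+1]≡[n+1]C[k+1] n k)) ⟩
  b +ⁿ (n C k +ⁿ n C suc k)               ≡⟨ sym (ℕ.+-assoc b _ _) ⟩
  b +ⁿ n C k +ⁿ n C suc k                 ≡⟨ cong₂ _+ⁿ_ (ballot-C 1 k) middle ⟩
  n C suc k +ⁿ n C suc (suc k)            ≡⟨ nCk+nC[k+1]≡[n+1]C[k+1] n (suc k) ⟩
  suc n C suc (suc k)                     ≡⟨ cong (λ m → (3 +ⁿ m) C suc (suc k)) (sym index) ⟩
  (3 +ⁿ (k +ⁿ suc k +ⁿ 0)) C suc (suc k)  ∎
  where
  b n : ℕ
  b = ballot 2 (suc k)
  n = 2 +ⁿ (k +ⁿ k +ⁿ 1)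
  index : k +ⁿ suc k +ⁿ 0 ≡ k +ⁿ k +ⁿ 1
  index = lemma k
    where
    lemma : ∀ k → k +ⁿ suc k +ⁿ 0 ≡ k +ⁿ k +ⁿ 1
    lemma = ℕ.solve-∀
  n-sum : n ≡ suc k +ⁿ suc (suc k)
  n-sum = lemma k
    where
    lemma : ∀ k → 2 +ⁿ (k +ⁿ k +ⁿ 1) ≡ suc k +ⁿ suc (suc k)
    lemma = ℕ.solve-∀
  -- At h = 0 the first term of the ballot recurrence is zero; correspondingly, the two central
  -- coefficients of the odd row n = 2k + 3 agree.
  middle : n C suc k ≡ n C suc (suc k)
  middle = subst (λ m → m C suc k ≡ m C suc (suc k)) (sym n-sum)
    (trans (nCk≡nC[n∸k] (ℕ.m≤m+n (suc k) (suc (suc k))))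
           (cong ((suc k +ⁿ suc (suc k)) C_) (ℕ.m+n∸m≡n (suc k) (suc (suc k)))))
ballot-C (suc h) zero = begin
  ballot (suc h) 1 +ⁿ 1 +ⁿ (3 +ⁿ h) C 0            ≡⟨ cong (ballot (suc h) 1 +ⁿ 1 +ⁿ_) (nC0≡1 (3 +ⁿ h)) ⟩
  ballot (suc h) 1 +ⁿ 1 +ⁿ 1                       ≡⟨ cong (λ c → ballot (suc h) 1 +ⁿ c +ⁿ 1) (sym (nC0≡1 (2 +ⁿ h))) ⟩
  ballot (suc h) 1 +ⁿ (2 +ⁿ h) C 0 +ⁿ 1            ≡⟨ cong (_+ⁿ 1) (ballot-C h 0) ⟩
  (2 +ⁿ h) C 1 +ⁿ 1                                ≡⟨ ℕ.+-comm _ 1 ⟩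
  1 +ⁿ (2 +ⁿ h) C 1                                ≡⟨ cong (_+ⁿ (2 +ⁿ h) C 1) (sym (nC0≡1 (2 +ⁿ h))) ⟩
  (2 +ⁿ h) C 0 +ⁿ (2 +ⁿ h) C 1                     ≡⟨ nCk+nC[k+1]≡[n+1]C[k+1] (2 +ⁿ h) 0 ⟩
  (3 +ⁿ h) C 1                                     ∎
ballot-C (suc h) (suc k) = begin
  b₁ +ⁿ b₂ +ⁿ (2 +ⁿ (suc k +ⁿ suc k +ⁿ suc h)) C suc k  ≡⟨ cong (λ m → b₁ +ⁿ b₂ +ⁿ (3 +ⁿ m) C suc k) index′ ⟩
  b₁ +ⁿ b₂ +ⁿ suc n C suc k                             ≡⟨ cong (b₁ +ⁿ b₂ +ⁿ_) (sym (nCk+nC[k+1]≡[n+1]C[k+1] n k)) ⟩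
  b₁ +ⁿ b₂ +ⁿ (n C k +ⁿ n C suc k)                      ≡⟨ interchange b₁ b₂ (n C k) (n C suc k) ⟩
  (b₂ +ⁿ n C k) +ⁿ (b₁ +ⁿ n C suc k)                    ≡⟨ cong₂ _+ⁿ_ (ballot-C (2 +ⁿ h) k)
      (subst (λ m → b₁ +ⁿ m C suc k ≡ m C suc (suc k)) (cong (2 +ⁿ_) index) (ballot-C h (suc k))) ⟩
  n C suc k +ⁿ n C suc (suc k)                          ≡⟨ nCk+nC[k+1]≡[n+1]C[k+1] n (suc k) ⟩
  suc n C suc (suc k)                                   ≡⟨ cong (λ m → (3 +ⁿ m) C suc (suc k)) (sym index′) ⟩
  (2 +ⁿ (suc k +ⁿ suc k +ⁿ suc h)) C suc (suc k)        ∎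
  where
  b₁ b₂ n : ℕ
  b₁ = ballot (suc h) (suc (suc k))
  b₂ = ballot (3 +ⁿ h) (suc k)
  n = 2 +ⁿ (k +ⁿ k +ⁿ (2 +ⁿ h))
  index : suc k +ⁿ suc k +ⁿ h ≡ k +ⁿ k +ⁿ (2 +ⁿ h)
  index = lemma k h
    where
    lemma : ∀ k h → suc k +ⁿ suc k +ⁿ h ≡ k +ⁿ k +ⁿ (2 +ⁿ h)
    lemma = ℕ.solve-∀
  index′ : k +ⁿ suc k +ⁿ suc h ≡ k +ⁿ k +ⁿ (2 +ⁿ h)
  index′ = lemma k h
    where
    lemma : ∀ k h → k +ⁿ suc k +ⁿ suc h ≡ k +ⁿ k +ⁿ (2 +ⁿ h)
    lemma = ℕ.solve-∀
  interchange : ∀ a b c d → a +ⁿ b +ⁿ (c +ⁿ d) ≡ (b +ⁿ c) +ⁿ (a +ⁿ d)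
  interchange = ℕ.solve-∀

-- This is (j + 1) C(n, j + 1) = (n - j) C(n, j), freed of the truncated subtraction.
C-absorb : ∀ n j → suc j *ⁿ (n C suc j) +ⁿ j *ⁿ (n C j) ≡ n *ⁿ (n C j)
C-absorb zero    zero    = refl
C-absorb zero    (suc j) = begin
  suc (suc j) *ⁿ (0 C suc (suc j)) +ⁿ suc j *ⁿ (0 C suc j)
    ≡⟨ cong₂ (λ x y → suc (suc j) *ⁿ x +ⁿ suc j *ⁿ y) (k>n⇒nCk≡0 {0} {suc (suc j)} (s≤s z≤n)) (k>n⇒nCk≡0 {0} {suc j} (s≤s z≤n)) ⟩
  suc (suc j) *ⁿ 0 +ⁿ suc j *ⁿ 0
    ≡⟨ cong₂ _+ⁿ_ (ℕ.*-zeroʳ (suc (suc j))) (ℕ.*-zeroʳ (suc j)) ⟩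
  0 ∎
C-absorb (suc n) zero    = begin
  (suc n C 1) +ⁿ 0 +ⁿ 0      ≡⟨ trans (ℕ.+-identityʳ _) (ℕ.+-identityʳ _) ⟩
  suc n C 1                  ≡⟨ nC1≡n (suc n) ⟩
  suc n                      ≡⟨ sym (ℕ.*-identityʳ (suc n)) ⟩
  suc n *ⁿ 1                 ≡⟨ cong (suc n *ⁿ_) (sym (nC0≡1 (suc n))) ⟩
  suc n *ⁿ (suc n C 0)       ∎
C-absorb (suc n) (suc j) = begin
  (2 +ⁿ j) *ⁿ (suc n C suc (suc j)) +ⁿ suc j *ⁿ (suc n C suc j)
    ≡⟨ cong₂ (λ x y → (2 +ⁿ j) *ⁿ x +ⁿ suc j *ⁿ y) (sym (nCk+nC[k+1]≡[n+1]C[k+1] n (suc j))) (sym (nCk+nC[k+1]≡[n+1]C[k+1] n j)) ⟩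
  (2 +ⁿ j) *ⁿ (c₁ +ⁿ c₂) +ⁿ suc j *ⁿ (c₀ +ⁿ c₁)
    ≡⟨ regroup j c₀ c₁ c₂ ⟩
  ((2 +ⁿ j) *ⁿ c₂ +ⁿ suc j *ⁿ c₁) +ⁿ (suc j *ⁿ c₁ +ⁿ j *ⁿ c₀) +ⁿ (c₀ +ⁿ c₁)
    ≡⟨ cong₂ (λ x y → x +ⁿ y +ⁿ (c₀ +ⁿ c₁)) (C-absorb n (suc j)) (C-absorb n j) ⟩
  n *ⁿ c₁ +ⁿ n *ⁿ c₀ +ⁿ (c₀ +ⁿ c₁)
    ≡⟨ collect n c₀ c₁ ⟩
  suc n *ⁿ (c₀ +ⁿ c₁)
    ≡⟨ cong (suc n *ⁿ_) (nCk+nC[k+1]≡[n+1]C[k+1] n j) ⟩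
  suc n *ⁿ (suc n C suc j) ∎
  where
  c₀ c₁ c₂ : ℕ
  c₀ = n C j
  c₁ = n C suc j
  c₂ = n C suc (suc j)
  regroup : ∀ j c₀ c₁ c₂ → (2 +ⁿ j) *ⁿ (c₁ +ⁿ c₂) +ⁿ suc j *ⁿ (c₀ +ⁿ c₁)
    ≡ ((2 +ⁿ j) *ⁿ c₂ +ⁿ suc j *ⁿ c₁) +ⁿ (suc j *ⁿ c₁ +ⁿ j *ⁿ c₀) +ⁿ (c₀ +ⁿ c₁)
  regroup = ℕ.solve-∀
  collect : ∀ n c₀ c₁ → n *ⁿ c₁ +ⁿ n *ⁿ c₀ +ⁿ (c₀ +ⁿ c₁) ≡ suc n *ⁿ (c₀ +ⁿ c₁)
  collect = ℕ.solve-∀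

-- For n = 2k + 2, reflection gives b = c₁ - c₀ and absorption gives (k + 1) c₁ = (k + 2) c₀. Hence
-- (k + 2) b = c₁, so the division in `catalan` returns b.
ballot-catalan : ∀ k → + ballot 1 k ≡ catalan k
ballot-catalan zero    = refl
ballot-catalan (suc k) = cong +_ (begin
  b                                       ≡⟨ sym (m*n/n≡m b (2 +ⁿ k)) ⟩
  (b *ⁿ (2 +ⁿ k)) /ⁿ (2 +ⁿ k)             ≡⟨ cong (_/ⁿ (2 +ⁿ k)) (ℕ.*-comm b (2 +ⁿ k)) ⟩
  ((2 +ⁿ k) *ⁿ b) /ⁿ (2 +ⁿ k)             ≡⟨ cong (_/ⁿ (2 +ⁿ k)) product ⟩
  c₁ /ⁿ (2 +ⁿ k)                          ≡⟨ cong (λ m → (m C suc k) /ⁿ (2 +ⁿ k)) (index k) ⟩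
  ((2 *ⁿ suc k) C suc k) /ⁿ suc (suc k)   ∎)
  where
  n b c₀ c₁ : ℕ
  n = 2 +ⁿ (k +ⁿ k +ⁿ 0)
  b = ballot 1 (suc k)
  c₀ = n C k
  c₁ = n C suc k
  index : ∀ k → 2 +ⁿ (k +ⁿ k +ⁿ 0) ≡ 2 *ⁿ suc k
  index = ℕ.solve-∀
  distribute : ∀ k b c → (2 +ⁿ k) *ⁿ b +ⁿ (2 +ⁿ k) *ⁿ c ≡ (b +ⁿ c) +ⁿ suc k *ⁿ (b +ⁿ c)
  distribute = ℕ.solve-∀
  double : ∀ k c → (2 +ⁿ (k +ⁿ k +ⁿ 0)) *ⁿ c ≡ (2 +ⁿ k) *ⁿ c +ⁿ k *ⁿ c
  double = ℕ.solve-∀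
  ratio : suc k *ⁿ c₁ ≡ (2 +ⁿ k) *ⁿ c₀
  ratio = ℕ.+-cancelʳ-≡ (k *ⁿ c₀) _ _ (trans (C-absorb n k) (double k c₀))
  product : (2 +ⁿ k) *ⁿ b ≡ c₁
  product = ℕ.+-cancelʳ-≡ ((2 +ⁿ k) *ⁿ c₀) _ _ (begin
    (2 +ⁿ k) *ⁿ b +ⁿ (2 +ⁿ k) *ⁿ c₀        ≡⟨ distribute k b c₀ ⟩
    (b +ⁿ c₀) +ⁿ suc k *ⁿ (b +ⁿ c₀)        ≡⟨ cong (λ c → c +ⁿ suc k *ⁿ c) (ballot-C 0 k) ⟩
    c₁ +ⁿ suc k *ⁿ c₁                      ≡⟨ cong (c₁ +ⁿ_) ratio ⟩
    c₁ +ⁿ (2 +ⁿ k) *ⁿ c₀                   ∎)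

ballotˢ : ℕ → Series
ballotˢ h k = + ballot h k

-- The generating function of the walks from height h down to 0 that end on
-- their first visit to 0, weighted by M for each step and z for each up-step.
descent : Series → ℕ → Series
descent M h = M ^ˢ h *ˢ (ballotˢ h ⟨ z *ˢ M ^ˢ 2 ⟩)

module _ (M : Series) where

  descent-zero : descent M 0 ≈ 1ˢ
  descent-zero = ≈-trans (*ˢ-identityˡ (ballotˢ 0 ⟨ z *ˢ M ^ˢ 2 ⟩))
    (≈-trans (⟨⟩-constant {ballotˢ 0} (z *ˢ M ^ˢ 2) (λ _ → refl)) (λ n → ℤ.*-identityˡ (1ˢ n)))

  descent-one : z *ˢ descent M 1 ≈ z *ˢ M *ˢ (catalan ⟨ z *ˢ M ^ˢ 2 ⟩)
  descent-one = ≈-trans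
    (solve 3 (λ z M B → z :* ((M :* con 1) :* B) := (z :* M) :* B) ≈-refl z M (ballotˢ 1 ⟨ z *ˢ M ^ˢ 2 ⟩))
    (*ˢ-cong {z *ˢ M} ≈-refl (⟨⟩-cong {ballotˢ 1} {catalan} (z *ˢ M ^ˢ 2) ballot-catalan))

  -- The ballot recurrence at x = z M²: the factor M² of x completes Mʰ to the power that height h +
  -- 2 requires. The factor A stands for whatever follows the first visit to 0.
  descent-suc : ∀ A h → A *ˢ descent M (suc h) ≈
    M *ˢ (A *ˢ descent M h +ˢ z *ˢ (A *ˢ descent M (2 +ⁿ h)))
  descent-suc A h = ≈-trans
    (*ˢ-cong {A} ≈-refl (*ˢ-cong {M ^ˢ suc h} ≈-refl
      (⟨⟩-shift (ballotˢ (suc h)) (ballotˢ h) (ballotˢ (2 +ⁿ h)) (z *ˢ M ^ˢ 2) refl (first h) (λ _ → refl))))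
    (solve 6 (λ A M P B z B″ →
        A :* ((M :* P) :* (B :+ (z :* (M :* (M :* con 1))) :* B″))
        := M :* (A :* (P :* B) :+ z :* (A :* ((M :* (M :* P)) :* B″))))
      ≈-refl A M (M ^ˢ h) (ballotˢ h ⟨ z *ˢ M ^ˢ 2 ⟩) z (ballotˢ (2 +ⁿ h) ⟨ z *ˢ M ^ˢ 2 ⟩))
    where
    first : ∀ h → ballotˢ (suc h) 0 ≡ ballotˢ h 0
    first zero    = refl
    first (suc h) = refl

-- Enumeration of sets of words

-- A cardinality is certified by an explicit list, so disjoint unions and injective images act on
-- lists directly. Two ways of counting one predicate are compared by `Count-functional`.
record Count (P : Word → Set) (c : ℤ) : Set where
  field
    list     : List Word
    unique   : Unique list
    sound    : ∀ {w} → w ∈ list → P w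
    complete : ∀ {w} → P w → w ∈ list
    size     : + length list ≡ c

open Count

Count-resp : ∀ {P Q c d} → (∀ {w} → P w → Q w) → (∀ {w} → Q w → P w) → c ≡ d → Count P c → Count Q d
Count-resp to from c≡d p = record
  { list     = list p
  ; unique   = unique p
  ; sound    = λ w∈ → to (sound p w∈)
  ; complete = λ q → complete p (from q)
  ; size     = trans (size p) c≡d
  }

Count-functional : ∀ {P c d} → Count P c → Count P d → c ≡ d
Count-functional p q = trans (sym (size p)) (trans (cong +_ (↭-length (∼bag⇒↭
  (unique∧set⇒bag (unique p) (unique q)
    (mk⇔ (λ w∈ → complete q (sound p w∈)) (λ w∈ → complete p (sound q w∈))))))) (size q))

Count-∅ : ∀ {P} → (∀ {w} → ¬ P w) → Count P 0ℤ
Count-∅ ¬P = record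
  { list = [] ; unique = [] ; sound = λ () ; complete = λ p → ⊥-elim (¬P p) ; size = refl }

Count-⊎ : ∀ {P Q c d} → (∀ {w} → P w → ¬ Q w) → Count P c → Count Q d → Count (λ w → P w ⊎ Q w) (c + d)
Count-⊎ disj p q = record
  { list     = list p ++ list q
  ; unique   = Unique.++⁺ (unique p) (unique q) λ (w∈p , w∈q) → disj (sound p w∈p) (sound q w∈q)
  ; sound    = λ w∈ → [ (λ w∈p → inj₁ (sound p w∈p)) , (λ w∈q → inj₂ (sound q w∈q)) ]′ (∈-++⁻ (list p) w∈)
  ; complete = [ (λ Pw → ∈-++⁺ˡ (complete p Pw)) , (λ Qw → ∈-++⁺ʳ (list p) (complete q Qw)) ]′
  ; size     = trans (cong +_ (length-++ (list p))) (cong₂ _+_ (size p) (size q))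
  }

Count-map : ∀ {P c} (f : Word → Word) → (∀ {v w} → f v ≡ f w → v ≡ w) →
  Count P c → Count (λ w → ∃[ v ] P v × w ≡ f v) c
Count-map f inj p = record
  { list     = map f (list p)
  ; unique   = Unique.map⁺ inj (unique p)
  ; sound    = λ w∈ → let v , v∈ , eq = ∈-map⁻ f w∈ in v , sound p v∈ , eq
  ; complete = λ { (v , Pv , refl) → ∈-map⁺ f (complete p Pv) }
  ; size     = trans (cong +_ (length-map f (list p))) (size p)
  }

Count-∑≤ : ∀ n {P : ℕ → Word → Set} {c : ℕ → ℤ} → (∀ {i j w} → P i w → P j w → i ≡ j) →
  (∀ i → i ≤ n → Count (P i) (c i)) → Count (λ w → ∃[ i ] i ≤ n × P i w) (∑≤ n c)
Count-∑≤ zero disj p = Count-resp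
  (λ Pw → 0 , z≤n , Pw) (λ { (.0 , z≤n , Pw) → Pw }) refl (p 0 z≤n)
Count-∑≤ (suc n) {P} disj p = Count-resp to from refl
  (Count-⊎ (λ { (i , i≤n , Pi) Pn → ℕ.1+n≰n (subst (_≤ n) (disj Pi Pn) i≤n) })
    (Count-∑≤ n {P} disj λ i i≤n → p i (ℕ.m≤n⇒m≤1+n i≤n)) (p (suc n) ℕ.≤-refl))
  where
  to : ∀ {w} → (∃[ i ] i ≤ n × P i w) ⊎ P (suc n) w → ∃[ i ] i ≤ suc n × P i w
  to (inj₁ (i , i≤n , Pi)) = i , ℕ.m≤n⇒m≤1+n i≤n , Pi
  to (inj₂ Pn)             = suc n , ℕ.≤-refl , Pn
  from : ∀ {w} → ∃[ i ] i ≤ suc n × P i w → (∃[ i ] i ≤ n × P i w) ⊎ P (suc n) w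
  from (i , i≤ , Pi) with ℕ.m≤n⇒m<n∨m≡n i≤
  ... | inj₁ (s≤s i≤n) = inj₁ (i , i≤n , Pi)
  ... | inj₂ refl      = inj₂ Pi

-- The fibres may be different sets but have a common size. Together with `Count-∑≤` this produces
-- Cauchy products: a choice of v, then one of c continuations.
Count-∈ : ∀ {vs} → Unique vs → {P : Word → Word → Set} {c : ℤ} →
  (∀ {u v w} → u ∈ vs → v ∈ vs → P u w → P v w → u ≡ v) →
  (∀ {v} → v ∈ vs → Count (P v) c) → Count (λ w → ∃[ v ] v ∈ vs × P v w) (+ length vs * c)
Count-∈ [] {c = c} disj p = subst (Count _) (sym (ℤ.*-zeroˡ c)) (Count-∅ λ { (_ , () , _) })
Count-∈ {v ∷ vs} (v∉ ∷ u) {P} {c} disj p = Count-resp to from (sym (ℤ.*-distribʳ-+ c 1ℤ (+ length vs)))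
  (Count-resp (λ x → x) (λ x → x) (cong (_+ + length vs * c) (sym (ℤ.*-identityˡ c)))
    (Count-⊎ (λ { Pv (v′ , v′∈ , Pv′) → All.lookup v∉ v′∈ (disj (here refl) (there v′∈) Pv Pv′) })
      (p (here refl)) (Count-∈ u {P} (λ x∈ y∈ → disj (there x∈) (there y∈)) λ x∈ → p (there x∈))))
  where
  to : ∀ {w} → P v w ⊎ (∃[ x ] x ∈ vs × P x w) → ∃[ x ] x ∈ v ∷ vs × P x w
  to (inj₁ Pv)            = v , here refl , Pv
  to (inj₂ (x , x∈ , Px)) = x , there x∈ , Px
  from : ∀ {w} → ∃[ x ] x ∈ v ∷ vs × P x w → P v w ⊎ (∃[ x ] x ∈ vs × P x w)
  from (x , here refl , Px) = inj₁ Px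
  from (x , there x∈ , Px)  = inj₂ (x , x∈ , Px)

-- Letter counts and suffixes of matchings

count : ℕ → Word → ℕ
count x w = length (filter (x ≟_) w)

count-++ : ∀ x u v → count x (u ++ v) ≡ count x u +ⁿ count x v
count-++ x u v = trans (cong length (filter-++ (x ≟_) u v)) (length-++ (filter (x ≟_) u))

count-∷ : ∀ x y w → count x (y ∷ w) ≡ count x [ y ] +ⁿ count x w
count-∷ x y w = count-++ x [ y ] w

count-self : ∀ x → count x [ x ] ≡ 1
count-self x = cong length (filter-accept (x ≟_) {xs = []} refl)

count-other : ∀ {x y} → x ≢ y → count x [ y ] ≡ 0
count-other {x} x≢y = cong length (filter-reject (x ≟_) {xs = []} x≢y)

∈⇒count : ∀ {x w} → x ∈ w → 1 ≤ count x w
∈⇒count {x} x∈w = ∈-length (∈-filter⁺ (x ≟_) x∈w refl)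

∉⇒count : ∀ {x w} → x ∉ w → count x w ≡ 0
∉⇒count {x} x∉w = cong length (filter-none (x ≟_) (All.tabulate λ y∈w x≡y → x∉w (subst (_∈ _) (sym x≡y) y∈w)))

count⇒∉ : ∀ {x w} → count x w ≡ 0 → x ∉ w
count⇒∉ {x} {w} eq x∈w = ℕ.1+n≰n (subst (1 ≤_) eq (∈⇒count x∈w))

count⇒∈ : ∀ {x w} → 1 ≤ count x w → x ∈ w
count⇒∈ {x} {w} 1≤ with x ∈? w
... | yes x∈w = x∈w
... | no  x∉w = ⊥-elim (ℕ.1+n≰n (subst (1 ≤_) (∉⇒count x∉w) 1≤))

⊆⇒count : ∀ x {u v} → u ⊆ v → count x u ≤ count x v
⊆⇒count x u⊆v = ⊆.length-mono-≤ (⊆.filter⁺ (x ≟_) (x ≟_) (λ { refl x≡y → x≡y }) u⊆v)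

count-map : ∀ (f : ℕ → ℕ) x w → (∀ {y} → y ∈ w → f x ≡ f y → x ≡ y) → count (f x) (map f w) ≡ count x w
count-map f x []      inj = refl
count-map f x (y ∷ w) inj = begin
  count (f x) (f y ∷ map f w)             ≡⟨ count-∷ (f x) (f y) (map f w) ⟩
  count (f x) [ f y ] +ⁿ count (f x) (map f w)  ≡⟨ cong₂ _+ⁿ_ head (count-map f x w λ y∈w → inj (there y∈w)) ⟩
  count x [ y ] +ⁿ count x w              ≡⟨ sym (count-∷ x y w) ⟩
  count x (y ∷ w)                         ∎
  where
  head : count (f x) [ f y ] ≡ count x [ y ]
  head with x ≟ y
  ... | yes refl = trans (count-self (f x)) (sym (count-self x))
  ... | no  x≢y  = trans (count-other λ eq → x≢y (inj (here refl) eq)) (sym (count-other x≢y))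

swap-+ : ∀ a b c → a +ⁿ (b +ⁿ c) ≡ b +ⁿ (a +ⁿ c)
swap-+ = ℕ.solve-∀

count⇒length : ∀ u v → (∀ x → count x u ≡ count x v) → length u ≡ length v
count⇒length []      []      eq = refl
count⇒length []      (y ∷ v) eq = ⊥-elim (count⇒∉ {w = y ∷ v} (sym (eq y)) (here refl))
count⇒length (x ∷ u) v       eq
  with v₁ , v₂ , refl ← ∈-∃++ (count⇒∈ {x} {v} (subst (1 ≤_) (eq x) (∈⇒count {w = x ∷ u} (here refl)))) = begin
  suc (length u)                   ≡⟨ cong suc (count⇒length u (v₁ ++ v₂) rest) ⟩
  suc (length (v₁ ++ v₂))          ≡⟨ cong suc (length-++ v₁) ⟩
  suc (length v₁ +ⁿ length v₂)     ≡⟨ sym (ℕ.+-suc (length v₁) (length v₂)) ⟩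
  length v₁ +ⁿ suc (length v₂)     ≡⟨ sym (length-++ v₁) ⟩
  length (v₁ ++ x ∷ v₂)            ∎
  where
  rest : ∀ y → count y u ≡ count y (v₁ ++ v₂)
  rest y = ℕ.+-cancelˡ-≡ (count y [ x ]) _ _ (begin
    count y [ x ] +ⁿ count y u                          ≡⟨ sym (count-∷ y x u) ⟩
    count y (x ∷ u)                                     ≡⟨ eq y ⟩
    count y (v₁ ++ x ∷ v₂)                              ≡⟨ count-++ y v₁ (x ∷ v₂) ⟩
    count y v₁ +ⁿ count y (x ∷ v₂)                      ≡⟨ cong (count y v₁ +ⁿ_) (count-∷ y x v₂) ⟩
    count y v₁ +ⁿ (count y [ x ] +ⁿ count y v₂)         ≡⟨ swap-+ (count y v₁) (count y [ x ]) (count y v₂) ⟩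
    count y [ x ] +ⁿ (count y v₁ +ⁿ count y v₂)         ≡⟨ cong (count y [ x ] +ⁿ_) (sym (count-++ y v₁ v₂)) ⟩
    count y [ x ] +ⁿ count y (v₁ ++ v₂)                 ∎)

range : ℕ → ℕ → List ℕ
range t zero    = []
range t (suc n) = suc t ∷ range (suc t) n

range-++ : ∀ t i j → range t (i +ⁿ j) ≡ range t i ++ range (i +ⁿ t) j
range-++ t zero    j = refl
range-++ t (suc i) j = cong (suc t ∷_) (trans (range-++ (suc t) i j)
  (cong (λ s → range (suc t) i ++ range s j) (ℕ.+-suc i t)))

∈-range⁻ : ∀ {x} t n → x ∈ range t n → t < x × x ≤ n +ⁿ t
∈-range⁻ t (suc n) (here refl) = ℕ.≤-refl , s≤s (ℕ.m≤n+m t n)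
∈-range⁻ {x} t (suc n) (there x∈)  with t<x , x≤ ← ∈-range⁻ (suc t) n x∈ =
  ℕ.<-trans (ℕ.n<1+n t) t<x , subst (x ≤_) (ℕ.+-suc n t) x≤

count-range-below : ∀ {x} t n → x ≤ t → count x (range t n) ≡ 0
count-range-below t n x≤t = ∉⇒count λ x∈ → ℕ.<⇒≱ (proj₁ (∈-range⁻ t n x∈)) x≤t

count-range-first : ∀ t n → count (suc t) (range t (suc n)) ≡ 1
count-range-first t n = trans (count-∷ (suc t) (suc t) (range (suc t) n))
  (cong₂ _+ⁿ_ (count-self (suc t)) (count-range-below (suc t) n ℕ.≤-refl))

count-range-≤1 : ∀ x t n → count x (range t n) ≤ 1
count-range-≤1 x t zero    = z≤n
count-range-≤1 x t (suc n) with x ≟ suc t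
... | yes refl = ℕ.≤-reflexive (count-range-first t n)
... | no  x≢   = subst (_≤ 1) (sym (trans (count-∷ x (suc t) (range (suc t) n))
  (cong (_+ⁿ count x (range (suc t) n)) (count-other x≢)))) (count-range-≤1 x (suc t) n)

∈-range⇒count : ∀ {x} t n → x ∈ range t n → count x (range t n) ≡ 1
∈-range⇒count t n x∈ = ℕ.≤-antisym (count-range-≤1 _ t n) (∈⇒count x∈)

letters≡range : ∀ n → letters n ≡ range 0 n
letters≡range n = shifted (λ i → i) 0 n λ i → sym (ℕ.+-identityʳ i)
  where
  shifted : ∀ (f : ℕ → ℕ) t n → (∀ i → f i ≡ i +ⁿ t) → map suc (applyUpTo f n) ≡ range t n
  shifted f t zero    f≡ = refl
  shifted f t (suc n) f≡ = cong₂ _∷_ (cong suc (f≡ 0))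
    (shifted (λ i → f (suc i)) (suc t) n λ i → trans (f≡ (suc i)) (sym (ℕ.+-suc i t)))

map-range : ∀ t s n → map (t +ⁿ_) (range s n) ≡ range (t +ⁿ s) n
map-range t s zero    = refl
map-range t s (suc n) = cong₂ _∷_ (ℕ.+-suc t s) (trans (map-range t (suc s) n) (cong (λ r → range r n) (ℕ.+-suc t s)))

length-range : ∀ t n → length (range t n) ≡ n
length-range t zero    = refl
length-range t (suc n) = cong suc (length-range (suc t) n)

-- Reading w from left to right, every letter is either at most t or one of
-- t + 1, …, t + n, the latter making their first appearance in this order.
data Ordered : ℕ → ℕ → Word → Set where
  []  : ∀ {t} → Ordered t 0 []
  old : ∀ {t n x w} → x ≤ t → Ordered t n w → Ordered t n (x ∷ w)
  new : ∀ {t n w} → Ordered (suc t) n w → Ordered t (suc n) (suc t ∷ w)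

Ordered-resp : ∀ {s t n w} → s ≡ t → Ordered s n w → Ordered t n w
Ordered-resp refl o = o

Ordered-++ : ∀ {t i j u v} → Ordered t i u → Ordered (i +ⁿ t) j v → Ordered t (i +ⁿ j) (u ++ v)
Ordered-++             []                    ov = ov
Ordered-++             (old x≤t ou)          ov = old x≤t (Ordered-++ ou ov)
Ordered-++ {t} {suc i} (new ou)              ov = new (Ordered-++ ou (Ordered-resp (sym (ℕ.+-suc i t)) ov))

Ordered-++⁻ : ∀ {t n} u {v} → Ordered t n (u ++ v) →
  ∃[ i ] ∃[ j ] n ≡ i +ⁿ j × Ordered t i u × Ordered (i +ⁿ t) j v
Ordered-++⁻ []      o           = 0 , _ , refl , [] , o
Ordered-++⁻ (x ∷ u) (old x≤t o) with i , j , eq , ou , ov ← Ordered-++⁻ u o = i , j , eq , old x≤t ou , ov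
Ordered-++⁻ {t} (x ∷ u) (new o) with i , j , eq , ou , ov ← Ordered-++⁻ u o =
  suc i , j , cong suc eq , new ou , Ordered-resp (ℕ.+-suc i t) ov

Ordered-≤ : ∀ {t n w x} → Ordered t n w → x ∈ w → x ≤ n +ⁿ t
Ordered-≤ {t} {n}     (old x≤t o) (here refl) = ℕ.≤-trans x≤t (ℕ.m≤n+m t n)
Ordered-≤             (old _ o)   (there x∈)  = Ordered-≤ o x∈
Ordered-≤ {t} {suc n} (new o)     (here refl) = s≤s (ℕ.m≤n+m t n)
Ordered-≤ {t} {suc n} {x = x} (new o) (there x∈)  = subst (x ≤_) (ℕ.+-suc n t) (Ordered-≤ o x∈)

Ordered-∈ : ∀ {t n w x} → Ordered t n w → x ∈ range t n → x ∈ w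
Ordered-∈ (old _ o) x∈          = there (Ordered-∈ o x∈)
Ordered-∈ (new o)   (here refl) = here refl
Ordered-∈ (new o)   (there x∈)  = there (Ordered-∈ o x∈)

Ordered-shift : ∀ t {s n w} → Ordered s n w → Ordered (t +ⁿ s) n (map (t +ⁿ_) w)
Ordered-shift t []          = []
Ordered-shift t (old x≤s o) = old (ℕ.+-monoʳ-≤ t x≤s) (Ordered-shift t o)
Ordered-shift t {s} {suc n} (new {w = w} o) = subst (λ x → Ordered (t +ⁿ s) (suc n) (x ∷ map (t +ⁿ_) w)) (sym (ℕ.+-suc t s))
  (new (Ordered-resp (ℕ.+-suc t s) (Ordered-shift t o)))

Ordered-unshift : ∀ t {s n} w → Ordered (t +ⁿ s) n (map (t +ⁿ_) w) → Ordered s n w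
Ordered-unshift t []      [] = []
Ordered-unshift t (x ∷ w) o = go o refl
  where
  go : ∀ {s n y} → Ordered (t +ⁿ s) n (y ∷ map (t +ⁿ_) w) → y ≡ t +ⁿ x → Ordered s n (x ∷ w)
  go {s} (old y≤ o) refl = old (ℕ.+-cancelˡ-≤ t x s y≤) (Ordered-unshift t w o)
  go {s} (new o)    eq with refl ← ℕ.+-cancelˡ-≡ t _ _ (trans (ℕ.+-suc t s) eq) =
    new (Ordered-unshift t w (Ordered-resp (sym (ℕ.+-suc t s)) o))

filter-filter : ∀ {P Q R : ℕ → Set} (P? : Decidable P) (Q? : Decidable Q) (R? : Decidable R) →
  (∀ {x} → P x → Q x → R x) → (∀ {x} → R x → P x × Q x) → ∀ w → filter P? (filter Q? w) ≡ filter R? w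
filter-filter P? Q? R? to from []      = refl
filter-filter P? Q? R? to from (x ∷ w) with Q? x
... | no ¬q = trans (filter-filter P? Q? R? to from w) (sym (filter-reject R? λ r → ¬q (proj₂ (from r))))
... | yes q with P? x
...   | no ¬p = trans (filter-filter P? Q? R? to from w) (sym (filter-reject R? λ r → ¬p (proj₁ (from r))))
...   | yes p = trans (cong (x ∷_) (filter-filter P? Q? R? to from w)) (sym (filter-accept R? (to p q)))

-- `deduplicate` deletes x from what follows it; a filter with threshold t ≥ x deletes x anyway. The
-- threshold thus replaces a record of the letters already seen.
filter-deduplicate-old : ∀ {t x} w → x ≤ t →
  filter (t <?_) (deduplicate _≟_ (x ∷ w)) ≡ filter (t <?_) (deduplicate _≟_ w)
filter-deduplicate-old {t} {x} w x≤t = trans (filter-reject (t <?_) (ℕ.≤⇒≯ x≤t))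
  (filter-filter (t <?_) (λ y → ¬? (x ≟ y)) (t <?_) (λ t<y _ → t<y) (λ t<y → t<y , λ { refl → ℕ.<⇒≱ t<y x≤t })
    (deduplicate _≟_ w))

filter-deduplicate-new : ∀ t w →
  filter (t <?_) (deduplicate _≟_ (suc t ∷ w)) ≡ suc t ∷ filter (suc t <?_) (deduplicate _≟_ w)
filter-deduplicate-new t w = trans (filter-accept (t <?_) ℕ.≤-refl) (cong (suc t ∷_)
  (filter-filter (t <?_) (λ y → ¬? (suc t ≟ y)) (suc t <?_)
    (λ t<y t≢y → ℕ.≤∧≢⇒< t<y t≢y) (λ 1+t<y → ℕ.<-trans (ℕ.n<1+n t) 1+t<y , λ { refl → ℕ.<-irrefl refl 1+t<y })
    (deduplicate _≟_ w)))

deduplicate⇒Ordered : ∀ t n w → filter (t <?_) (deduplicate _≟_ w) ≡ range t n → Ordered t n w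
deduplicate⇒Ordered t zero    [] eq = []
deduplicate⇒Ordered t n       (x ∷ w) eq with t <? x
deduplicate⇒Ordered t n       (x ∷ w) eq | no t≮x = old (ℕ.≮⇒≥ t≮x)
  (deduplicate⇒Ordered t n w (trans (sym (filter-deduplicate-old w (ℕ.≮⇒≥ t≮x))) eq))
deduplicate⇒Ordered t zero    (x ∷ w) eq | yes t<x with () ← trans (sym (filter-accept (t <?_) t<x)) eq
deduplicate⇒Ordered t (suc n) (x ∷ w) eq | yes t<x with refl ← ∷-injectiveˡ (trans (sym (filter-accept (t <?_) t<x)) eq) =
  new (deduplicate⇒Ordered (suc t) n w (∷-injectiveʳ (trans (sym (filter-deduplicate-new t w)) eq)))

Ordered⇒deduplicate : ∀ {t n w} → Ordered t n w → filter (t <?_) (deduplicate _≟_ w) ≡ range t n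
Ordered⇒deduplicate []                    = refl
Ordered⇒deduplicate (old {w = w} x≤t o)   = trans (filter-deduplicate-old w x≤t) (Ordered⇒deduplicate o)
Ordered⇒deduplicate {t} (new {w = w} o)   = trans (filter-deduplicate-new t w) (cong (suc t ∷_) (Ordered⇒deduplicate o))

infixr 4 _,_

-- A suffix of a matching, with o the letters of the edges that are open at
-- its beginning, t the number of letters used before it and n that of the
-- letters first used in it.
record Suffix (o : List ℕ) (t n : ℕ) (w : Word) : Set where
  constructor _,_
  field
    ordered  : Ordered t n w
    balanced : ∀ x → count x w ≡ count x o +ⁿ 2 *ⁿ count x (range t n)

open Suffix

length-Suffix : ∀ {t n w} → Suffix [] t n w → length w ≡ 2 *ⁿ n
length-Suffix {t} {n} {w} (_ , bal) = begin
  length w                                  ≡⟨ count⇒length w (range t n ++ range t n) (λ x →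
      trans (bal x) (trans (cong (count x (range t n) +ⁿ_) (ℕ.+-identityʳ _)) (sym (count-++ x (range t n) (range t n))))) ⟩
  length (range t n ++ range t n)           ≡⟨ length-++ (range t n) ⟩
  length (range t n) +ⁿ length (range t n)  ≡⟨ cong₂ _+ⁿ_ (length-range t n) (trans (length-range t n) (sym (ℕ.+-identityʳ n))) ⟩
  2 *ⁿ n                                    ∎

Suffix⇒∈range : ∀ {t n w x} → Suffix [] t n w → x ∈ w → x ∈ range t n
Suffix⇒∈range {t} {n} {x = x} (_ , bal) x∈w = count⇒∈ (positive (count x (range t n)) (subst (1 ≤_) (bal x) (∈⇒count x∈w)))
  where
  positive : ∀ c → 1 ≤ 2 *ⁿ c → 1 ≤ c
  positive (suc c) _ = s≤s z≤n

IsMatching⇒Suffix : ∀ {n w} → IsMatching n w → Suffix [] 0 n w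
IsMatching⇒Suffix {n} {w} (_ , twice , dedup) = deduplicate⇒Ordered 0 n w
  (trans (filter-all (0 <?_) (All.tabulate λ x∈ → proj₁ (∈-range⁻ 0 n (subst (_ ∈_) dedup′ x∈)))) dedup′) , bal
  where
  dedup′ : deduplicate _≟_ w ≡ range 0 n
  dedup′ = trans dedup (letters≡range n)
  bal : ∀ x → count x w ≡ 2 *ⁿ count x (range 0 n)
  bal x with x ∈? range 0 n
  ... | yes x∈ = trans (All.lookup twice (subst (x ∈_) (sym (letters≡range n)) x∈)) (cong (2 *ⁿ_) (sym (∈-range⇒count 0 n x∈)))
  ... | no  x∉ = trans (∉⇒count λ x∈w → x∉ (subst (x ∈_) dedup′ (∈-deduplicate⁺ _≟_ x∈w))) (cong (2 *ⁿ_) (sym (∉⇒count x∉)))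

Suffix⇒IsMatching : ∀ {n w} → Suffix [] 0 n w → IsMatching n w
Suffix⇒IsMatching {n} {w} s@(o , bal) = length-Suffix s
  , All.tabulate (λ {x} x∈ → trans (bal x) (cong (2 *ⁿ_) (∈-range⇒count 0 n (subst (x ∈_) (letters≡range n) x∈))))
  , trans (sym (filter-all (0 <?_) (All.tabulate λ x∈ → proj₁ (∈-range⁻ 0 n (Suffix⇒∈range s (∈-deduplicate⁻ _≟_ w x∈))))))
      (trans (Ordered⇒deduplicate o) (sym (letters≡range n)))

Suffix-shift : ∀ t {n w} → Suffix [] 0 n w → Suffix [] t n (map (t +ⁿ_) w)
Suffix-shift t {n} {w} s@(o , bal) = Ordered-resp (ℕ.+-identityʳ t) (Ordered-shift t o) , bal′
  where
  bal′ : ∀ x → count x (map (t +ⁿ_) w) ≡ 2 *ⁿ count x (range t n)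
  bal′ x with t ≤? x
  ... | yes t≤x with y , refl ← ℕ.m≤n⇒∃[o]m+o≡n t≤x = begin
    count (t +ⁿ y) (map (t +ⁿ_) w)                     ≡⟨ count-map (t +ⁿ_) y w (λ _ → ℕ.+-cancelˡ-≡ t _ _) ⟩
    count y w                                          ≡⟨ bal y ⟩
    2 *ⁿ count y (range 0 n)                           ≡⟨ cong (2 *ⁿ_) (sym (count-map (t +ⁿ_) y (range 0 n) (λ _ → ℕ.+-cancelˡ-≡ t _ _))) ⟩
    2 *ⁿ count (t +ⁿ y) (map (t +ⁿ_) (range 0 n))      ≡⟨ cong (λ r → 2 *ⁿ count (t +ⁿ y) r)
        (trans (map-range t 0 n) (cong (λ s → range s n) (ℕ.+-identityʳ t))) ⟩
    2 *ⁿ count (t +ⁿ y) (range t n)                    ∎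
  ... | no  t≰x = trans
    (∉⇒count {w = map (t +ⁿ_) w} λ x∈ → let y , _ , eq = ∈-map⁻ (t +ⁿ_) x∈ in t≰x (subst (t ≤_) (sym eq) (ℕ.m≤m+n t y)))
    (cong (2 *ⁿ_) (sym (count-range-below t n (ℕ.≰⇒≥ t≰x))))

Suffix-unshift : ∀ {t n w} → Suffix [] t n w → ∃[ m ] Suffix [] 0 n m × w ≡ map (t +ⁿ_) m
Suffix-unshift {t} {n} {w} s@(o , bal) = map (_∸ t) w , (Ordered-unshift t (map (_∸ t) w)
    (subst₂ (λ s v → Ordered s n v) (sym (ℕ.+-identityʳ t)) w≡ o) , bal′) , w≡
  where
  w≡ : w ≡ map (t +ⁿ_) (map (_∸ t) w)
  w≡ = trans (sym (map-id-local (All.tabulate λ x∈ → ℕ.m+[n∸m]≡n (ℕ.<⇒≤ (proj₁ (∈-range⁻ t n (Suffix⇒∈range s x∈))))))) (map-∘ w)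
  bal′ : ∀ x → count x (map (_∸ t) w) ≡ 2 *ⁿ count x (range 0 n)
  bal′ x = begin
    count x (map (_∸ t) w)                             ≡⟨ sym (count-map (t +ⁿ_) x (map (_∸ t) w) (λ _ → ℕ.+-cancelˡ-≡ t _ _)) ⟩
    count (t +ⁿ x) (map (t +ⁿ_) (map (_∸ t) w))        ≡⟨ cong (count (t +ⁿ x)) (sym w≡) ⟩
    count (t +ⁿ x) w                                   ≡⟨ bal (t +ⁿ x) ⟩
    2 *ⁿ count (t +ⁿ x) (range t n)                    ≡⟨ cong (λ r → 2 *ⁿ count (t +ⁿ x) r)
        (sym (trans (map-range t 0 n) (cong (λ s → range s n) (ℕ.+-identityʳ t)))) ⟩
    2 *ⁿ count (t +ⁿ x) (map (t +ⁿ_) (range 0 n))      ≡⟨ cong (2 *ⁿ_) (count-map (t +ⁿ_) x (range 0 n) (λ _ → ℕ.+-cancelˡ-≡ t _ _)) ⟩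
    2 *ⁿ count x (range 0 n)                           ∎

count-range-++ : ∀ x t i j → 2 *ⁿ count x (range t (i +ⁿ j)) ≡ 2 *ⁿ count x (range t i) +ⁿ 2 *ⁿ count x (range (i +ⁿ t) j)
count-range-++ x t i j = trans
  (cong (2 *ⁿ_) (trans (cong (count x) (range-++ t i j)) (count-++ x (range t i) (range (i +ⁿ t) j))))
  (ℕ.*-distribˡ-+ 2 (count x (range t i)) (count x (range (i +ⁿ t) j)))

Suffix-++ : ∀ {o t i j m r} → Suffix [] t i m → Suffix o (i +ⁿ t) j r → Suffix o t (i +ⁿ j) (m ++ r)
Suffix-++ {o} {t} {i} {j} {m} {r} (om , bm) (or , br) = Ordered-++ om or , λ x → begin
  count x (m ++ r)                                     ≡⟨ count-++ x m r ⟩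
  count x m +ⁿ count x r                               ≡⟨ cong₂ _+ⁿ_ (bm x) (br x) ⟩
  2 *ⁿ count x (range t i) +ⁿ (count x o +ⁿ 2 *ⁿ count x (range (i +ⁿ t) j))
                                                       ≡⟨ swap-+ (2 *ⁿ count x (range t i)) (count x o) _ ⟩
  count x o +ⁿ (2 *ⁿ count x (range t i) +ⁿ 2 *ⁿ count x (range (i +ⁿ t) j))
                                                       ≡⟨ cong (count x o +ⁿ_) (sym (count-range-++ x t i j)) ⟩
  count x o +ⁿ 2 *ⁿ count x (range t (i +ⁿ j))         ∎

-- All letters first used in m are at most i + t. A letter of m is therefore not new in r, and by
-- hypothesis neither open nor in r, so its entire balance falls to m.
Suffix-++⁻ : ∀ {o t n} m {r} → Suffix o t n (m ++ r) → (∀ {x} → x ∈ m → x ∉ r) → (∀ {x} → x ∈ m → x ∉ o) →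
  ∃[ i ] ∃[ j ] n ≡ i +ⁿ j × Suffix [] t i m × Suffix o (i +ⁿ t) j r
Suffix-++⁻ {o} {t} m {r} (ord , bal) m∩r m∩o with i , j , refl , om , or ← Ordered-++⁻ m ord =
  i , j , refl , (om , bm) , (or , br)
  where
  expand : ∀ x → count x m +ⁿ count x r ≡ count x o +ⁿ (2 *ⁿ count x (range t i) +ⁿ 2 *ⁿ count x (range (i +ⁿ t) j))
  expand x = trans (sym (count-++ x m r)) (trans (bal x) (cong (count x o +ⁿ_) (count-range-++ x t i j)))
  bm : ∀ x → count x m ≡ 2 *ⁿ count x (range t i)
  bm x with x ∈? m
  ... | no  x∉ = trans (∉⇒count x∉) (cong (2 *ⁿ_) (sym (∉⇒count λ x∈ → x∉ (Ordered-∈ om x∈))))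
  ... | yes x∈ = begin
    count x m                                 ≡⟨ sym (ℕ.+-identityʳ _) ⟩
    count x m +ⁿ 0                            ≡⟨ cong (count x m +ⁿ_) (sym (∉⇒count (m∩r x∈))) ⟩
    count x m +ⁿ count x r                    ≡⟨ expand x ⟩
    count x o +ⁿ (2 *ⁿ count x (range t i) +ⁿ 2 *ⁿ count x (range (i +ⁿ t) j))
      ≡⟨ cong₂ (λ c d → c +ⁿ (2 *ⁿ count x (range t i) +ⁿ 2 *ⁿ d)) (∉⇒count (m∩o x∈)) (count-range-below (i +ⁿ t) j (Ordered-≤ om x∈)) ⟩
    2 *ⁿ count x (range t i) +ⁿ 0             ≡⟨ ℕ.+-identityʳ _ ⟩
    2 *ⁿ count x (range t i)                  ∎
  br : ∀ x → count x r ≡ count x o +ⁿ 2 *ⁿ count x (range (i +ⁿ t) j)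
  br x = ℕ.+-cancelˡ-≡ (count x m) _ _ (begin
    count x m +ⁿ count x r                    ≡⟨ expand x ⟩
    count x o +ⁿ (2 *ⁿ count x (range t i) +ⁿ 2 *ⁿ count x (range (i +ⁿ t) j))
      ≡⟨ swap-+ (count x o) (2 *ⁿ count x (range t i)) _ ⟩
    2 *ⁿ count x (range t i) +ⁿ (count x o +ⁿ 2 *ⁿ count x (range (i +ⁿ t) j))
      ≡⟨ cong (_+ⁿ (count x o +ⁿ 2 *ⁿ count x (range (i +ⁿ t) j))) (sym (bm x)) ⟩
    count x m +ⁿ (count x o +ⁿ 2 *ⁿ count x (range (i +ⁿ t) j)) ∎)

Suffix-close : ∀ {a o t n w} → Suffix o t n w → a ≤ t → Suffix (a ∷ o) t n (a ∷ w)
Suffix-close {a} {o} {t} {n} {w} (ord , bal) a≤t = old a≤t ord , λ x → begin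
  count x (a ∷ w)                                        ≡⟨ count-∷ x a w ⟩
  count x [ a ] +ⁿ count x w                             ≡⟨ cong (count x [ a ] +ⁿ_) (bal x) ⟩
  count x [ a ] +ⁿ (count x o +ⁿ 2 *ⁿ count x (range t n)) ≡⟨ sym (ℕ.+-assoc (count x [ a ]) _ _) ⟩
  count x [ a ] +ⁿ count x o +ⁿ 2 *ⁿ count x (range t n) ≡⟨ cong (_+ⁿ 2 *ⁿ count x (range t n)) (sym (count-∷ x a o)) ⟩
  count x (a ∷ o) +ⁿ 2 *ⁿ count x (range t n)            ∎

Suffix-close⁻ : ∀ {a o t n w} → Suffix (a ∷ o) t n (a ∷ w) → a ≤ t → Suffix o t n w
Suffix-close⁻ {a} {o} {t} {n} {w} (ord , bal) a≤t = drop-head ord , λ x → ℕ.+-cancelˡ-≡ (count x [ a ]) _ _ (begin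
  count x [ a ] +ⁿ count x w                             ≡⟨ sym (count-∷ x a w) ⟩
  count x (a ∷ w)                                        ≡⟨ bal x ⟩
  count x (a ∷ o) +ⁿ 2 *ⁿ count x (range t n)            ≡⟨ cong (_+ⁿ 2 *ⁿ count x (range t n)) (count-∷ x a o) ⟩
  count x [ a ] +ⁿ count x o +ⁿ 2 *ⁿ count x (range t n) ≡⟨ ℕ.+-assoc (count x [ a ]) _ _ ⟩
  count x [ a ] +ⁿ (count x o +ⁿ 2 *ⁿ count x (range t n)) ∎)
  where
  drop-head : Ordered t n (a ∷ w) → Ordered t n w
  drop-head (old _ o) = o
  drop-head (new o)   = ⊥-elim (ℕ.1+n≰n a≤t)

private
  open-identity : ∀ a o r → o +ⁿ 2 *ⁿ (a +ⁿ r) ≡ a +ⁿ (o +ⁿ (a +ⁿ 0) +ⁿ 2 *ⁿ r)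
  open-identity = ℕ.solve-∀

  open-count : ∀ x o t n → count x o +ⁿ 2 *ⁿ count x (range t (suc n)) ≡
    count x [ suc t ] +ⁿ (count x (o ++ [ suc t ]) +ⁿ 2 *ⁿ count x (range (suc t) n))
  open-count x o t n = begin
    count x o +ⁿ 2 *ⁿ count x (range t (suc n))
      ≡⟨ cong (λ c → count x o +ⁿ 2 *ⁿ c) (count-∷ x (suc t) (range (suc t) n)) ⟩
    count x o +ⁿ 2 *ⁿ (count x [ suc t ] +ⁿ count x (range (suc t) n))
      ≡⟨ open-identity (count x [ suc t ]) (count x o) _ ⟩
    count x [ suc t ] +ⁿ (count x o +ⁿ (count x [ suc t ] +ⁿ 0) +ⁿ 2 *ⁿ count x (range (suc t) n))
      ≡⟨ cong (λ c → count x [ suc t ] +ⁿ (c +ⁿ 2 *ⁿ count x (range (suc t) n)))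
           (trans (cong (count x o +ⁿ_) (ℕ.+-identityʳ _)) (sym (count-++ x o [ suc t ]))) ⟩
    count x [ suc t ] +ⁿ (count x (o ++ [ suc t ]) +ⁿ 2 *ⁿ count x (range (suc t) n)) ∎

Suffix-open : ∀ {o t n w} → Suffix (o ++ [ suc t ]) (suc t) n w → Suffix o t (suc n) (suc t ∷ w)
Suffix-open {o} {t} {n} {w} (ord , bal) = new ord , λ x → begin
  count x (suc t ∷ w)                          ≡⟨ count-∷ x (suc t) w ⟩
  count x [ suc t ] +ⁿ count x w               ≡⟨ cong (count x [ suc t ] +ⁿ_) (bal x) ⟩
  count x [ suc t ] +ⁿ (count x (o ++ [ suc t ]) +ⁿ 2 *ⁿ count x (range (suc t) n)) ≡⟨ sym (open-count x o t n) ⟩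
  count x o +ⁿ 2 *ⁿ count x (range t (suc n))  ∎

-- A letter that is at most t and not open has no copies left, so a first letter outside o must be
-- the next new one.
Suffix-open⁻ : ∀ {b o t n w} → Suffix o t n (b ∷ w) → b ∉ o →
  ∃[ n′ ] n ≡ suc n′ × b ≡ suc t × Suffix (o ++ [ suc t ]) (suc t) n′ w
Suffix-open⁻ {b} {o} {t} {n} {w} (old b≤t _ , bal) b∉o = ⊥-elim (count⇒∉ {w = b ∷ w}
  (trans (bal b) (cong₂ (λ c d → c +ⁿ 2 *ⁿ d) (∉⇒count b∉o) (count-range-below t n b≤t))) (here refl))
Suffix-open⁻ {b} {o} {t} {suc n} {w} (new ord , bal) b∉o = n , refl , refl , (ord , λ x →
  ℕ.+-cancelˡ-≡ (count x [ suc t ]) _ _ (begin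
    count x [ suc t ] +ⁿ count x w               ≡⟨ sym (count-∷ x (suc t) w) ⟩
    count x (suc t ∷ w)                          ≡⟨ bal x ⟩
    count x o +ⁿ 2 *ⁿ count x (range t (suc n))  ≡⟨ open-count x o t n ⟩
    count x [ suc t ] +ⁿ (count x (o ++ [ suc t ]) +ⁿ 2 *ⁿ count x (range (suc t) n)) ∎))

-- Occurrences of patterns

InjectiveOn : Word → (ℕ → ℕ) → Set
InjectiveOn π f = ∀ {x y} → x ∈ π → y ∈ π → f x ≡ f y → x ≡ y

-- A relabelling followed by a subword embedding replaces vectors of positions. Such an embedding
-- can be cut along any concatenation that forms τ, which the case analyses below do.
Occurs : Word → Word → Set
Occurs π τ = ∃[ f ] InjectiveOn π f × map f π ⊆ τ

lower : ∀ {m k} (v : Vec (Fin (suc m)) k) → (∀ p → zero {m} Fin.< Vec.lookup v p) → ∃[ u ] v ≡ Vec.map suc u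
lower []          pos = [] , refl
lower (zero ∷ v)  pos = ⊥-elim (ℕ.<-irrefl refl (pos zero))
lower (suc i ∷ v) pos with u , refl ← lower v (λ p → pos (suc p)) = i ∷ u , refl

lower-increasing : ∀ {m k} (u : Vec (Fin m) k) → StrictlyIncreasing (Vec.map suc u) → StrictlyIncreasing u
lower-increasing u inc p q p<q =
  ℕ.≤-pred (subst₂ Fin._<_ (Vec.lookup-map p suc u) (Vec.lookup-map q suc u) (inc p q p<q))

module _ (f : ℕ → ℕ) where

  positions : ∀ {π τ} → map f π ⊆ τ → Vec (Fin (length τ)) (length π)
  positions {[]}    _        = []
  positions {x ∷ π} (y ∷ʳ e) = Vec.map suc (positions e)
  positions {x ∷ π} (_ ∷ e)  = zero ∷ Vec.map suc (positions e)

  lookup-positions : ∀ {π τ} (e : map f π ⊆ τ) p →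
    List.lookup τ (Vec.lookup (positions e) p) ≡ f (List.lookup π p)
  lookup-positions {x ∷ π} {y ∷ τ} (y ∷ʳ e) p =
    trans (cong (List.lookup (y ∷ τ)) (Vec.lookup-map p suc (positions e))) (lookup-positions {x ∷ π} e p)
  lookup-positions {x ∷ π} (eq ∷ e) zero    = sym eq
  lookup-positions {x ∷ π} {y ∷ τ} (eq ∷ e) (suc p) =
    trans (cong (List.lookup (y ∷ τ)) (Vec.lookup-map p suc (positions e))) (lookup-positions {π} e p)

  positions-increasing : ∀ {π τ} (e : map f π ⊆ τ) → StrictlyIncreasing (positions e)
  positions-increasing {x ∷ π} (y ∷ʳ e) p q p<q =
    subst₂ Fin._<_ (sym (Vec.lookup-map p suc (positions e))) (sym (Vec.lookup-map q suc (positions e)))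
      (s≤s (positions-increasing {x ∷ π} e p q p<q))
  positions-increasing {x ∷ π} {y ∷ τ} (_ ∷ e) zero    (suc q) _         =
    subst (Fin._<_ (zero {length τ})) (sym (Vec.lookup-map q suc (positions e))) (s≤s z≤n)
  positions-increasing {x ∷ π} (_ ∷ e) (suc p) (suc q) (s≤s p<q) =
    subst₂ Fin._<_ (sym (Vec.lookup-map p suc (positions e))) (sym (Vec.lookup-map q suc (positions e)))
      (s≤s (positions-increasing {π} e p q p<q))

  increasing⇒⊆ : ∀ π τ (is : Vec (Fin (length τ)) (length π)) → StrictlyIncreasing is →
    (∀ p → List.lookup τ (Vec.lookup is p) ≡ f (List.lookup π p)) → map f π ⊆ τ
  increasing⇒⊆ []      τ       is           inc eq = minimum τ
  increasing⇒⊆ (x ∷ π) (y ∷ τ) (zero ∷ is)  inc eq with u , refl ← lower is (λ p → inc zero (suc p) (s≤s z≤n)) =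
    sym (eq zero) ∷ increasing⇒⊆ π τ u (lower-increasing u λ p q p<q → inc (suc p) (suc q) (s≤s p<q))
      (λ p → trans (cong (List.lookup (y ∷ τ)) (sym (Vec.lookup-map p suc u))) (eq (suc p)))
  increasing⇒⊆ (x ∷ π) (y ∷ τ) (suc i ∷ is) inc eq
    with u , refl ← lower is (λ p → ℕ.<-trans (s≤s z≤n) (inc zero (suc p) (s≤s z≤n))) =
    y ∷ʳ increasing⇒⊆ (x ∷ π) τ (i ∷ u) (lower-increasing (i ∷ u) inc)
      (λ p → trans (cong (List.lookup (y ∷ τ)) (sym (Vec.lookup-map p suc (i ∷ u)))) (eq p))

increasing⇒injective : ∀ {m k} (is : Vec (Fin m) k) → StrictlyIncreasing is →
  ∀ {p q} → Vec.lookup is p ≡ Vec.lookup is q → p ≡ q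
increasing⇒injective is inc {p} {q} eq with Fin.<-cmp p q
... | tri< p<q _ _ = ⊥-elim (Fin.<-irrefl eq (inc p q p<q))
... | tri≈ _ p≡q _ = p≡q
... | tri> _ _ q<p = ⊥-elim (Fin.<-irrefl (sym eq) (inc q p q<p))

Occurs⇒IsPatternOf : ∀ {π τ} → Occurs π τ → π IsPatternOf τ
Occurs⇒IsPatternOf {π} {τ} (f , inj , e) = positions f e , positions-increasing f {π} e , λ p q →
  (λ { (≢ , eq) → (λ { refl → ≢ refl }) , inj (∈-lookup p) (∈-lookup q)
      (trans (sym (lookup-positions f {π} e p)) (trans eq (lookup-positions f {π} e q))) }) ,
  (λ { (≢ , eq) → (λ same → ≢ (increasing⇒injective (positions f e) (positions-increasing f {π} e) same)) ,
      trans (lookup-positions f {π} e p) (trans (cong f eq) (sym (lookup-positions f {π} e q))) })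

-- The letter a is sent to the letter of τ at the image of any position that carries a. Preservation
-- of edges makes this well defined, reflection of edges makes it injective.
IsPatternOf⇒Occurs : ∀ {π τ} → π IsPatternOf τ → Occurs π τ
IsPatternOf⇒Occurs {π} {τ} (is , inc , edges) = f , inj , increasing⇒⊆ f π τ is inc (λ p → sym (f-lookup p))
  where
  image : Fin (length π) → ℕ
  image p = List.lookup τ (Vec.lookup is p)
  image-cong : ∀ p q → List.lookup π p ≡ List.lookup π q → image p ≡ image q
  image-cong p q eq with p Fin.≟ q
  ... | yes refl = refl
  ... | no  p≢q  = proj₂ (proj₂ (edges p q) (p≢q , eq))
  image-inj : ∀ p q → image p ≡ image q → List.lookup π p ≡ List.lookup π q
  image-inj p q eq with Vec.lookup is p Fin.≟ Vec.lookup is q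
  ... | yes same = cong (List.lookup π) (increasing⇒injective is inc same)
  ... | no  diff = proj₂ (proj₁ (edges p q) (diff , eq))
  f : ℕ → ℕ
  f a with Fin.any? (λ p → List.lookup π p ≟ a)
  ... | yes (p , _) = image p
  -- An arbitrary value: `InjectiveOn π f` and `map f π` see only the letters of π.
  ... | no  _       = 0
  f-lookup : ∀ p → f (List.lookup π p) ≡ image p
  f-lookup p with Fin.any? (λ q → List.lookup π q ≟ List.lookup π p)
  ... | yes (q , eq) = image-cong q p eq
  ... | no  none     = ⊥-elim (none (p , refl))
  inj : InjectiveOn π f
  inj {x} {y} x∈ y∈ eq = trans x≡ (trans (image-inj p q (begin
    image p                ≡⟨ sym (f-lookup p) ⟩
    f (List.lookup π p)    ≡⟨ cong f (sym x≡) ⟩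
    f x                    ≡⟨ eq ⟩
    f y                    ≡⟨ cong f y≡ ⟩
    f (List.lookup π q)    ≡⟨ f-lookup q ⟩
    image q                ∎)) (sym y≡))
    where
    p q : Fin (length π)
    p = Any.index x∈
    q = Any.index y∈
    x≡ : x ≡ List.lookup π p
    x≡ = Any.lookup-index x∈
    y≡ : y ≡ List.lookup π q
    y≡ = Any.lookup-index y∈

Occurs-mono : ∀ {π τ τ′} → τ ⊆ τ′ → Occurs π τ → Occurs π τ′
Occurs-mono τ⊆ (f , inj , e) = f , inj , ⊆-trans e τ⊆

Occurs-shift : ∀ t {π τ} → Occurs π τ → Occurs π (map (t +ⁿ_) τ)
Occurs-shift t {π} (f , inj , e) = (λ x → t +ⁿ f x) , (λ x∈ y∈ eq → inj x∈ y∈ (ℕ.+-cancelˡ-≡ t _ _ eq)) ,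
  subst (_⊆ _) (sym (map-∘ π)) (⊆.map⁺ (t +ⁿ_) e)

Occurs-unshift : ∀ t {π τ} → Occurs π (map (t +ⁿ_) τ) → Occurs π τ
Occurs-unshift t {π} {τ} (f , inj , e) = (λ x → f x ∸ t) ,
  (λ x∈ y∈ eq → inj x∈ y∈ (ℕ.∸-cancelʳ-≡ (t≤ x∈) (t≤ y∈) eq)) ,
  subst₂ _⊆_ (sym (map-∘ π)) (trans (sym (map-∘ τ)) (map-id-local (All.tabulate λ {x} _ → ℕ.m+n∸m≡n t x))) (⊆.map⁺ (_∸ t) e)
  where
  t≤ : ∀ {x} → x ∈ π → t ≤ f x
  t≤ x∈ with y , _ , eq ← ∈-map⁻ (t +ⁿ_) (lookup e (∈-map⁺ f x∈)) = subst (t ≤_) (sym eq) (ℕ.m≤m+n t y)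

⊆-++⁻ : ∀ {s : Word} u {v} → s ⊆ u ++ v → ∃[ p ] ∃[ r ] s ≡ p ++ r × p ⊆ u × r ⊆ v
⊆-++⁻ []      e        = [] , _ , refl , [] , e
⊆-++⁻ (x ∷ u) (x ∷ʳ e) with p , r , eq , p⊆ , r⊆ ← ⊆-++⁻ u e = p , r , eq , x ∷ʳ p⊆ , r⊆
⊆-++⁻ (x ∷ u) (x≡ ∷ e) with p , r , refl , p⊆ , r⊆ ← ⊆-++⁻ u e = _ ∷ p , r , refl , x≡ ∷ p⊆ , r⊆

⊆-∷⁻ : ∀ {a : ℕ} {q w} → a ∷ q ⊆ w → ∃[ u ] ∃[ v ] w ≡ u ++ a ∷ v × q ⊆ v
⊆-∷⁻ (x ∷ʳ e)   with u , v , refl , q⊆ ← ⊆-∷⁻ e = x ∷ u , v , refl , q⊆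
⊆-∷⁻ (refl ∷ e) = [] , _ , refl , e

++-∷ʳ⁻ : ∀ u (x : ℕ) v y w → u ++ [ x ] ≡ v ++ y ∷ w → ∃[ w′ ] y ∷ w ≡ w′ ++ [ x ] × u ≡ v ++ w′
++-∷ʳ⁻ u       x []      y w eq = u , sym eq , refl
++-∷ʳ⁻ []      x (_ ∷ []) y w ()
++-∷ʳ⁻ []      x (_ ∷ _ ∷ v) y w ()
++-∷ʳ⁻ (a ∷ u) x (b ∷ v) y w eq with refl ← ∷-injectiveˡ eq
  with w′ , eq₁ , eq₂ ← ++-∷ʳ⁻ u x v y w (∷-injectiveʳ eq) = w′ , eq₁ , cong (a ∷_) eq₂

map-++⁻ : ∀ (f : ℕ → ℕ) π {p r} → map f π ≡ p ++ r → ∃[ u ] ∃[ v ] π ≡ u ++ v × map f u ≡ p × map f v ≡ r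
map-++⁻ f π       {[]}    eq = [] , π , refl , refl , eq
map-++⁻ f (x ∷ π) {_ ∷ p} eq with u , v , refl , eq₁ , eq₂ ← map-++⁻ f π {p} (∷-injectiveʳ eq) =
  x ∷ u , v , refl , cong₂ _∷_ (∷-injectiveˡ eq) eq₁ , eq₂

count-twice : ∀ {x u v} → x ∈ u → x ∈ v → 2 ≤ count x (u ++ v)
count-twice {x} {u} {v} x∈u x∈v = subst (2 ≤_) (sym (count-++ x u v)) (ℕ.+-mono-≤ (∈⇒count x∈u) (∈⇒count x∈v))

-- The source of the order contradictions below: two open edges, each closed once in r, cannot be
-- closed in both orders.
⊆-antisymmetric-pair : ∀ {x y r} → x ∷ y ∷ [] ⊆ r → y ∷ x ∷ [] ⊆ r → x ≢ y → count x r ≤ 1 → count y r ≤ 1 → ⊥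
⊆-antisymmetric-pair {x} {y} xy yx x≢y x≤1 y≤1 with u , v , refl , y⊆v ← ⊆-∷⁻ xy with ⊆-++⁻ u yx
... | []         , _ , refl , _   , (_ ∷ʳ e) =
  ℕ.<⇒≱ (count-twice {u = u ++ [ x ]} {v} (∈-++⁺ʳ u (here refl)) (lookup e (there (here refl))))
  (subst (λ r → count x r ≤ 1) (sym (++-assoc u [ x ] v)) x≤1)
... | []         , _ , refl , _   , (y≡x ∷ _) = x≢y (sym y≡x)
... | _ ∷ []     , _ , refl , y∈u , _ = ℕ.<⇒≱ (count-twice {u = u} {x ∷ v} (to∈ y∈u) (there (to∈ y⊆v))) y≤1
... | _ ∷ _ ∷ [] , _ , refl , p⊆  , _ = ℕ.<⇒≱ (count-twice {u = u} {x ∷ v} (lookup p⊆ (there (here refl))) (here refl)) x≤1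

Double : Word → Set
Double π = ∀ {x} → x ∈ π → count x π ≡ 2

Suffix⇒Double : ∀ {t n w} → Suffix [] t n w → Double w
Suffix⇒Double {t} {n} s {x} x∈ = trans (balanced s x) (cong (2 *ⁿ_) (∈-range⇒count t n (Suffix⇒∈range s x∈)))

Double-map : ∀ {π f} → Double π → InjectiveOn π f → Double (map f π)
Double-map {π} {f} dbl inj x∈ with a , a∈ , refl ← ∈-map⁻ f x∈ = trans (count-map f a π λ y∈ → inj a∈ y∈) (dbl a∈)

Double-lifting : ∀ {π} → 0 ∉ π → Double π → Double (lifting π)
Double-lifting {π} 0∉ dbl {x} x∈ = trans (count-∷ x 1 (map suc π ++ [ 1 ]))
  (trans (cong (count x [ 1 ] +ⁿ_) (count-++ x (map suc π) [ 1 ])) (go x∈))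
  where
  one∉ : 1 ∉ map suc π
  one∉ 1∈ with .0 , 0∈ , refl ← ∈-map⁻ suc 1∈ = 0∉ 0∈
  outer : count 1 [ 1 ] +ⁿ (count 1 (map suc π) +ⁿ count 1 [ 1 ]) ≡ 2
  outer = cong (λ c → 1 +ⁿ (c +ⁿ 1)) (∉⇒count one∉)
  inner : ∀ {a} → a ∈ π → count (suc a) [ 1 ] +ⁿ (count (suc a) (map suc π) +ⁿ count (suc a) [ 1 ]) ≡ 2
  inner {a} a∈ = trans (cong (λ c → c +ⁿ (count (suc a) (map suc π) +ⁿ c)) (count-other {suc a} {1} λ { refl → 0∉ a∈ }))
    (trans (ℕ.+-identityʳ _) (trans (count-map suc a π λ _ → ℕ.suc-injective) (dbl a∈)))
  go : x ∈ lifting π → count x [ 1 ] +ⁿ (count x (map suc π) +ⁿ count x [ 1 ]) ≡ 2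
  go (here refl) = outer
  go (there x∈′) with ∈-++⁻ (map suc π) x∈′
  ... | inj₂ (here refl) = outer
  ... | inj₁ x∈″ with a , a∈ , refl ← ∈-map⁻ suc x∈″ = inner a∈

lifting-∉ : ∀ {π f} → 0 ∉ π → InjectiveOn (lifting π) f → f 1 ∉ map f (map suc π)
lifting-∉ {f = f} 0∉ inj f1∈
  with y , y∈ , eq ← ∈-map⁻ f f1∈
  with refl ← inj (here refl) (there (∈-++⁺ˡ y∈)) eq
  with .0 , 0∈ , refl ← ∈-map⁻ suc y∈ = 0∉ 0∈

lifting-Double : ∀ {π f} → Double π → InjectiveOn (lifting π) f → Double (map f (map suc π))
lifting-Double dbl inj = Double-map (Double-map dbl λ _ _ → ℕ.suc-injective)
  λ x∈ y∈ → inj (there (∈-++⁺ˡ x∈)) (there (∈-++⁺ˡ y∈))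

χ-Double : Double χ
χ-Double = Suffix⇒Double (IsMatching⇒Suffix {3} (toWitness {a? = isMatching? 3 χ} tt))

χ̄-Double : Double χ̄
χ̄-Double = Suffix⇒Double (IsMatching⇒Suffix {3} (toWitness {a? = isMatching? 3 χ̄} tt))

triple : ℕ → ℕ → ℕ → ℕ → ℕ
triple x y z 1 = x
triple x y z 2 = y
triple x y z _ = z

triple-injective : ∀ {x y z} → x ≢ y → x ≢ z → y ≢ z → ∀ {a b} →
  a ∈ 1 ∷ 2 ∷ 3 ∷ [] → b ∈ 1 ∷ 2 ∷ 3 ∷ [] → triple x y z a ≡ triple x y z b → a ≡ b
triple-injective x≢y x≢z y≢z (here refl)                 (here refl)                 eq = refl
triple-injective x≢y x≢z y≢z (here refl)                 (there (here refl))         eq = ⊥-elim (x≢y eq)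
triple-injective x≢y x≢z y≢z (here refl)                 (there (there (here refl))) eq = ⊥-elim (x≢z eq)
triple-injective x≢y x≢z y≢z (there (here refl))         (here refl)                 eq = ⊥-elim (x≢y (sym eq))
triple-injective x≢y x≢z y≢z (there (here refl))         (there (here refl))         eq = refl
triple-injective x≢y x≢z y≢z (there (here refl))         (there (there (here refl))) eq = ⊥-elim (y≢z eq)
triple-injective x≢y x≢z y≢z (there (there (here refl))) (here refl)                 eq = ⊥-elim (x≢z (sym eq))
triple-injective x≢y x≢z y≢z (there (there (here refl))) (there (here refl))         eq = ⊥-elim (y≢z (sym eq))
triple-injective x≢y x≢z y≢z (there (there (here refl))) (there (there (here refl))) eq = refl

occurs-χ : ∀ {x y z τ} → x ≢ y → x ≢ z → y ≢ z → x ∷ y ∷ z ∷ x ∷ z ∷ y ∷ [] ⊆ τ → Occurs χ τ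
occurs-χ {x} {y} {z} x≢y x≢z y≢z e = triple x y z ,
  -- `deduplicate` evaluates the pattern to its three distinct letters, which leaves nine cases
  -- instead of thirty-six.
  (λ a∈ b∈ → triple-injective x≢y x≢z y≢z (∈-deduplicate⁺ _≟_ a∈) (∈-deduplicate⁺ _≟_ b∈)) , e

occurs-χ̄ : ∀ {x y z τ} → x ≢ y → x ≢ z → y ≢ z → x ∷ y ∷ z ∷ y ∷ x ∷ z ∷ [] ⊆ τ → Occurs χ̄ τ
occurs-χ̄ {x} {y} {z} x≢y x≢z y≢z e = triple x y z ,
  (λ a∈ b∈ → triple-injective x≢y x≢z y≢z (∈-deduplicate⁺ _≟_ a∈) (∈-deduplicate⁺ _≟_ b∈)) , e

-- A factor closed under taking the partner of a vertex is empty or the whole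
-- word.
Rigid : Word → Set
Rigid π = ∀ (i j : Fin (suc (length π))) →
  let u = take (toℕ i) π
      v = take (toℕ j) (drop (toℕ i) π)
      w = drop (toℕ j) (drop (toℕ i) π)
  in All (_∉ u) v → All (_∉ w) v → v ≡ [] ⊎ (u ≡ [] × w ≡ [])

rigid? : Decidable Rigid
rigid? π = Fin.all? λ i → Fin.all? λ j →
  let u = take (toℕ i) π
      v = take (toℕ j) (drop (toℕ i) π)
      w = drop (toℕ j) (drop (toℕ i) π)
  in All.all? (λ x → ¬? (x ∈? u)) v →-dec All.all? (λ x → ¬? (x ∈? w)) v →-dec
     (≡-dec _≟_ v [] ⊎-dec (≡-dec _≟_ u [] ×-dec ≡-dec _≟_ w []))

χ-Rigid : Rigid χ
χ-Rigid = toWitness {a? = rigid? χ} tt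

χ̄-Rigid : Rigid χ̄
χ̄-Rigid = toWitness {a? = rigid? χ̄} tt

take-length-++ : ∀ (u v : Word) → take (length u) (u ++ v) ≡ u
take-length-++ []      v = refl
take-length-++ (x ∷ u) v = cong (x ∷_) (take-length-++ u v)

drop-length-++ : ∀ (u v : Word) → drop (length u) (u ++ v) ≡ v
drop-length-++ []      v = refl
drop-length-++ (x ∷ u) v = drop-length-++ u v

-- `Rigid` ranges over bounded cut positions so that evaluation can decide it for χ and χ̄; here
-- these are traded for an arbitrary factorization.
Rigid-factor : ∀ {π} → Rigid π → ∀ u v w → π ≡ u ++ v ++ w →
  (∀ {x} → x ∈ v → x ∉ u) → (∀ {x} → x ∈ v → x ∉ w) → v ≡ [] ⊎ (u ≡ [] × w ≡ [])
Rigid-factor rigid u v w refl v∩u v∩w = split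
  (trans (cong (λ n → take n uvw) i≡) (take-length-++ u (v ++ w)))
  (trans (cong₂ take j≡ rest≡) (take-length-++ v w))
  (trans (cong₂ drop j≡ rest≡) (drop-length-++ v w))
  (rigid (fromℕ< u<) (fromℕ< v<))
  where
  uvw : Word
  uvw = u ++ v ++ w
  u< : length u < suc (length uvw)
  u< = s≤s (length-++-≤ˡ u)
  v< : length v < suc (length uvw)
  v< = s≤s (ℕ.≤-trans (length-++-≤ˡ v) (length-++-≤ʳ (v ++ w) {u}))
  i≡ : toℕ (fromℕ< u<) ≡ length u
  i≡ = Fin.toℕ-fromℕ< u<
  j≡ : toℕ (fromℕ< v<) ≡ length v
  j≡ = Fin.toℕ-fromℕ< v<
  rest≡ : drop (toℕ (fromℕ< u<)) uvw ≡ v ++ w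
  rest≡ = trans (cong (λ n → drop n uvw) i≡) (drop-length-++ u (v ++ w))
  split : ∀ {u′ v′ w′} → u′ ≡ u → v′ ≡ v → w′ ≡ w →
    (All (_∉ u′) v′ → All (_∉ w′) v′ → v′ ≡ [] ⊎ (u′ ≡ [] × w′ ≡ [])) → v ≡ [] ⊎ (u ≡ [] × w ≡ [])
  split refl refl refl r = r (All.tabulate v∩u) (All.tabulate v∩w)

-- Each letter of s occurs twice, and a occurs in the big word only at the two displayed places, so
-- s uses both of them or neither.
⊆-front : ∀ {a q w s} → a ∉ q → a ∉ w → Double s → s ⊆ a ∷ q ++ a ∷ w →
  s ⊆ q ++ w ⊎ (∃[ p ] ∃[ r ] s ≡ a ∷ p ++ a ∷ r × p ⊆ q × r ⊆ w)
⊆-front {a} {q} {w} {s} a∉q a∉w dbl (_ ∷ʳ e) with ⊆-++⁻ q e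
... | p , r     , refl , p⊆ , (_ ∷ʳ r⊆)   = inj₁ (⊆.++⁺ p⊆ r⊆)
... | p , _ ∷ r , refl , p⊆ , (refl ∷ r⊆) = ⊥-elim (1≢2 (trans (sym once) (dbl (∈-++⁺ʳ p (here refl)))))
  where
  1≢2 : 1 ≢ 2
  1≢2 ()
  once : count a (p ++ a ∷ r) ≡ 1
  once = trans (count-++ a p (a ∷ r)) (trans (cong₂ _+ⁿ_ (∉⇒count λ x∈ → a∉q (lookup p⊆ x∈)) (count-∷ a a r))
    (cong₂ _+ⁿ_ (count-self a) (∉⇒count λ x∈ → a∉w (lookup r⊆ x∈))))
⊆-front {a} {q} {w} {s} a∉q a∉w dbl (refl ∷ e) with ⊆-++⁻ q e
... | p , _ ∷ r , refl , p⊆ , (refl ∷ r⊆) = inj₂ (p , r , refl , p⊆ , r⊆)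
... | p , r     , refl , p⊆ , (_ ∷ʳ r⊆)   = ⊥-elim (1≢2 (trans (sym once) (dbl (here refl))))
  where
  1≢2 : 1 ≢ 2
  1≢2 ()
  once : count a (a ∷ p ++ r) ≡ 1
  once = trans (count-∷ a a (p ++ r)) (cong₂ _+ⁿ_ (count-self a) (trans (count-++ a p r)
    (cong₂ _+ⁿ_ (∉⇒count λ x∈ → a∉q (lookup p⊆ x∈)) (∉⇒count λ x∈ → a∉w (lookup r⊆ x∈)))))

++-∷-unique : ∀ {a : ℕ} u {v} u′ {v′} → a ∉ u → a ∉ u′ → u ++ a ∷ v ≡ u′ ++ a ∷ v′ → u ≡ u′ × v ≡ v′
++-∷-unique []      []       a∉ a∉′ eq = refl , ∷-injectiveʳ eq
++-∷-unique []      (x ∷ u′) a∉ a∉′ eq = ⊥-elim (a∉′ (here (∷-injectiveˡ eq)))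
++-∷-unique (x ∷ u) []       a∉ a∉′ eq = ⊥-elim (a∉ (here (sym (∷-injectiveˡ eq))))
++-∷-unique (x ∷ u) (y ∷ u′) a∉ a∉′ eq
  with eq₁ , eq₂ ← ++-∷-unique u u′ (λ a∈ → a∉ (there a∈)) (λ a∈ → a∉′ (there a∈)) (∷-injectiveʳ eq) =
  cong₂ _∷_ (∷-injectiveˡ eq) eq₁ , eq₂

-- The oldest open edge a is put back: it opens before the queue q and closes before the rest w. A
-- new occurrence would begin with a, and its part between the two copies of a would embed in q,
-- where no letter repeats and whose edges are closed in w in the order of q.
module Front {a : ℕ} {q w : Word} (a∉q : a ∉ q) (a∉w : a ∉ w) (q⊆w : q ⊆ w)
  (once : ∀ {x} → x ∈ q → count x q ≤ 1) (once′ : ∀ {x} → x ∈ q → count x w ≤ 1) where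

  χ-front : Occurs χ (a ∷ q ++ a ∷ w) → Occurs χ (q ++ w)
  χ-front (f , inj , e) =
    [ (λ e′ → f , inj , e′) , (λ c → ⊥-elim (crossing c)) ]′ (⊆-front a∉q a∉w (Double-map χ-Double inj) e)
    where
    f1∉ : f 1 ∉ f 2 ∷ f 3 ∷ []
    f1∉ (here eq)         with () ← inj (here refl) (there (here refl)) eq
    f1∉ (there (here eq)) with () ← inj (here refl) (there (there (here refl))) eq
    2≢3 : f 2 ≢ f 3
    2≢3 eq with () ← inj (there (here refl)) (there (there (here refl))) eq
    crossing : ¬ (∃[ p ] ∃[ r ] map f χ ≡ a ∷ p ++ a ∷ r × p ⊆ q × r ⊆ w)
    crossing (p , r , eq , p⊆ , r⊆)
      with eq₁ , eq₂ ← ∷-injective eq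
      with refl , refl ← ++-∷-unique (f 2 ∷ f 3 ∷ []) p (subst (_∉ _) eq₁ f1∉) (λ a∈ → a∉q (lookup p⊆ a∈))
             (trans (cong (λ x → f 2 ∷ f 3 ∷ x ∷ f 3 ∷ f 2 ∷ []) (sym eq₁)) eq₂) =
      -- The images of 2 and 3 lie in this order in q and hence in w, but χ ends with 3 2.
      ⊆-antisymmetric-pair (⊆-trans p⊆ q⊆w) r⊆ 2≢3
        (once′ (lookup p⊆ (here refl))) (once′ (lookup p⊆ (there (here refl))))

  χ̄-front : Occurs χ̄ (a ∷ q ++ a ∷ w) → Occurs χ̄ (q ++ w)
  χ̄-front (f , inj , e) =
    [ (λ e′ → f , inj , e′) , (λ c → ⊥-elim (crossing c)) ]′ (⊆-front a∉q a∉w (Double-map χ̄-Double inj) e)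
    where
    f1∉ : f 1 ∉ f 2 ∷ f 3 ∷ f 2 ∷ []
    f1∉ (here eq)                 with () ← inj (here refl) (there (here refl)) eq
    f1∉ (there (here eq))         with () ← inj (here refl) (there (there (here refl))) eq
    f1∉ (there (there (here eq))) with () ← inj (here refl) (there (here refl)) eq
    crossing : ¬ (∃[ p ] ∃[ r ] map f χ̄ ≡ a ∷ p ++ a ∷ r × p ⊆ q × r ⊆ w)
    crossing (p , r , eq , p⊆ , r⊆)
      with eq₁ , eq₂ ← ∷-injective eq
      with refl , refl ← ++-∷-unique (f 2 ∷ f 3 ∷ f 2 ∷ []) p (subst (_∉ _) eq₁ f1∉) (λ a∈ → a∉q (lookup p⊆ a∈))
             (trans (cong (λ x → f 2 ∷ f 3 ∷ f 2 ∷ x ∷ f 3 ∷ []) (sym eq₁)) eq₂) =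
      -- Between its two letters 1, χ̄ contains 2 twice.
      ℕ.<⇒≱ (ℕ.≤-trans (count-twice {u = [ f 2 ]} {f 3 ∷ f 2 ∷ []} (here refl) (there (here refl))) (⊆⇒count (f 2) p⊆))
        (once (lookup p⊆ (here refl)))

  lifting-front : ∀ {π} → 0 ∉ π → π ≢ [] → Double π → Occurs (lifting π) (a ∷ q ++ a ∷ w) → Occurs (lifting π) (q ++ w)
  lifting-front {[]}    0∉ π≢ dbl _ = ⊥-elim (π≢ refl)
  lifting-front {c ∷ π} 0∉ π≢ dbl (f , inj , e) =
    [ (λ e′ → f , inj , e′) , (λ c → ⊥-elim (crossing c)) ]′ (⊆-front a∉q a∉w (Double-map (Double-lifting 0∉ dbl) inj) e)
    where
    g : Word
    g = map f (map suc (c ∷ π))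
    crossing : ¬ (∃[ p ] ∃[ r ] map f (lifting (c ∷ π)) ≡ a ∷ p ++ a ∷ r × p ⊆ q × r ⊆ w)
    crossing (p , r , eq , p⊆ , r⊆)
      with eq₁ , eq₂ ← ∷-injective eq
      with refl , _ ← ++-∷-unique g p (subst (_∉ g) eq₁ (lifting-∉ 0∉ inj)) (λ a∈ → a∉q (lookup p⊆ a∈))
             (trans (cong (λ x → g ++ [ x ]) (sym eq₁)) (trans (sym (map-++ f (map suc (c ∷ π)) [ 1 ])) eq₂)) =
      ℕ.<⇒≱ (ℕ.≤-trans (ℕ.≤-reflexive (sym (lifting-Double dbl inj (here refl)))) (⊆⇒count (f (suc c)) p⊆))
        (once (lookup p⊆ (here refl)))

-- A closed word m inserted behind the queue q of open edges, which are later
-- closed in r in the same order.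
module Insert {q m r : Word} (q⊆r : q ⊆ r)
  (once : ∀ {x} → x ∈ q → count x q ≤ 1) (once′ : ∀ {x} → x ∈ q → count x r ≤ 1)
  (m∩q : ∀ {x} → x ∈ m → x ∉ q) (m∩r : ∀ {x} → x ∈ m → x ∉ r) where

  -- The letters of m occur in neither q nor r, so the factor of π embedded in m is closed under
  -- partners. Rigidity leaves only the empty factor and all of π.
  Rigid-insert : ∀ {π} → Rigid π → Occurs π (q ++ m ++ r) → Occurs π m ⊎ Occurs π (q ++ r)
  Rigid-insert {π} rigid (f , inj , e)
    with p₁ , p′ , eq , p₁⊆ , p′⊆ ← ⊆-++⁻ q e
    with p₂ , p₃ , refl , p₂⊆ , p₃⊆ ← ⊆-++⁻ m p′⊆
    with u , v′ , eq₁ , refl , eq₁′ ← map-++⁻ f π {p₁} {p₂ ++ p₃} eq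
    with v , w , refl , refl , refl ← map-++⁻ f v′ {p₂} {p₃} eq₁′
    with Rigid-factor rigid u v w eq₁
           (λ x∈v x∈u → m∩q (lookup p₂⊆ (∈-map⁺ f x∈v)) (lookup p₁⊆ (∈-map⁺ f x∈u)))
           (λ x∈v x∈w → m∩r (lookup p₂⊆ (∈-map⁺ f x∈v)) (lookup p₃⊆ (∈-map⁺ f x∈w)))
  ... | inj₁ refl          = inj₂ (f , inj , subst (_⊆ q ++ r) (sym eq) (⊆.++⁺ p₁⊆ p₃⊆))
  ... | inj₂ (refl , refl) = inj₁ (f , inj , subst (_⊆ m) (sym (trans eq (++-identityʳ _))) p₂⊆)

  -- Let p₁, p₂, p₃ be the parts of the occurrence in q, m, r, with p₂ nonempty. The outer edge lies
  -- in m together with all of π, or it runs from q to r. In the latter case the order of the queue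
  -- leaves only its left end in p₁, and connectedness puts π into p₂.
  lifting-insert : ∀ {π} → 0 ∉ π → Double π →
    (∀ u v → π ≡ u ++ v → (∀ {x} → x ∈ u → x ∉ v) → u ≡ [] ⊎ v ≡ []) →
    Occurs (lifting π) (q ++ m ++ r) → Occurs π m ⊎ Occurs (lifting π) (q ++ r)
  lifting-insert {π} 0∉ dbl conn (f , inj , e)
    with p₁ , p′ , eq , p₁⊆ , p′⊆ ← ⊆-++⁻ q e
    with p₂ , p₃ , refl , p₂⊆ , p₃⊆ ← ⊆-++⁻ m p′⊆ =
    go p₁ p₂ p₃ p₁⊆ p₂⊆ p₃⊆ (trans (cong (f 1 ∷_) (sym (map-++ f (map suc π) [ 1 ]))) eq) eq
    where
    g : Word
    g = map f (map suc π)
    f′ : ℕ → ℕ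
    f′ x = f (suc x)
    ∈-lifting : ∀ {x} → x ∈ map suc π → x ∈ lifting π
    ∈-lifting x∈ = there (∈-++⁺ˡ x∈)
    f′-injective : InjectiveOn π f′
    f′-injective x∈ y∈ eq = ℕ.suc-injective (inj (∈-lifting (∈-map⁺ suc x∈)) (∈-lifting (∈-map⁺ suc y∈)) eq)
    go : ∀ p₁ p₂ p₃ → p₁ ⊆ q → p₂ ⊆ m → p₃ ⊆ r → f 1 ∷ g ++ [ f 1 ] ≡ p₁ ++ p₂ ++ p₃ → map f (lifting π) ≡ p₁ ++ p₂ ++ p₃ →
      Occurs π m ⊎ Occurs (lifting π) (q ++ r)
    go p₁ [] p₃ p₁⊆ p₂⊆ p₃⊆ eq eq′ = inj₂ (f , inj , subst (_⊆ q ++ r) (sym eq′) (⊆.++⁺ p₁⊆ p₃⊆))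
    go [] (y ∷ p₂) [] p₁⊆ p₂⊆ p₃⊆ eq eq′ = inj₁ (f′ , f′-injective ,
      subst (_⊆ m) (sym (map-∘ π)) (⊆-trans (f 1 ∷ʳ ⊆.++⁺ʳ [ f 1 ] ⊆-refl)
        (subst (_⊆ m) (sym (trans eq (++-identityʳ _))) p₂⊆)))
    go [] (y ∷ p₂) (y′ ∷ p₃) p₁⊆ p₂⊆ p₃⊆ eq eq′
      with w′ , p₃≡ , _ ← ++-∷ʳ⁻ g (f 1) p₂ y′ p₃ (∷-injectiveʳ eq) =
      ⊥-elim (m∩r (lookup p₂⊆ (here (∷-injectiveˡ eq))) (lookup p₃⊆ (subst (f 1 ∈_) (sym p₃≡) (∈-++⁺ʳ w′ (here refl)))))
    go (x ∷ p₁) (y ∷ p₂) [] p₁⊆ p₂⊆ p₃⊆ eq eq′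
      with w′ , p₂≡ , _ ← ++-∷ʳ⁻ g (f 1) p₁ y p₂ (trans (∷-injectiveʳ eq) (cong (p₁ ++_) (++-identityʳ _))) =
      ⊥-elim (m∩q (lookup p₂⊆ (subst (f 1 ∈_) (sym p₂≡) (∈-++⁺ʳ w′ (here refl)))) (lookup p₁⊆ (here (∷-injectiveˡ eq))))
    go (x ∷ p₁) (y ∷ p₂) (y′ ∷ p₃) p₁⊆ p₂⊆ p₃⊆ eq eq′
      with refl ← ∷-injectiveˡ eq
      with w′ , p₃≡ , g-split ← ++-∷ʳ⁻ g (f 1) (p₁ ++ y ∷ p₂) y′ p₃
             (trans (∷-injectiveʳ eq) (sym (++-assoc p₁ (y ∷ p₂) (y′ ∷ p₃)))) =
      inside p₁ p₁⊆ (trans g-split (++-assoc p₁ (y ∷ p₂) w′))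
      where
      w′⊆ : w′ ++ [ f 1 ] ⊆ r
      w′⊆ = subst (_⊆ r) p₃≡ p₃⊆
      inside : ∀ p₁ → f 1 ∷ p₁ ⊆ q → g ≡ p₁ ++ (y ∷ p₂) ++ w′ → Occurs π m ⊎ Occurs (lifting π) (q ++ r)
      inside [] p₁⊆ g≡ with u , v , π≡ , u≡ , v≡ ← map-++⁻ f′ π {y ∷ p₂} {w′} (trans (map-∘ π) g≡)
        with conn u v π≡ (λ x∈u x∈v → m∩r (lookup p₂⊆ (subst (_ ∈_) u≡ (∈-map⁺ f′ x∈u)))
               (lookup w′⊆ (∈-++⁺ˡ (subst (_ ∈_) v≡ (∈-map⁺ f′ x∈v)))))
      ... | inj₁ refl with () ← u≡
      ... | inj₂ refl = inj₁ (f′ , f′-injective ,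
        subst (_⊆ m) (sym (trans (cong (map f′) (trans π≡ (++-identityʳ u))) u≡)) p₂⊆)
      -- An edge d opened in q after `f 1` has its second copy in w′, before the closing `f 1`; yet
      -- `q ⊆ r` closes `f 1` before d.
      inside (d ∷ p₁) p₁⊆ g≡ = ⊥-elim (⊆-antisymmetric-pair
        (⊆-trans (⊆-trans (refl ∷ refl ∷ minimum p₁) p₁⊆) q⊆r)
        (⊆-trans (⊆.++⁺ (from∈ d∈w′) ⊆-refl) w′⊆)
        (λ { refl → lifting-∉ 0∉ inj d∈g }) (once′ (lookup p₁⊆ (here refl))) (once′ d∈q))
        where
        d∈q : d ∈ q
        d∈q = lookup p₁⊆ (there (here refl))
        d∈g : d ∈ g
        d∈g = subst (d ∈_) (sym g≡) (here refl)
        counts : count d (d ∷ p₁) +ⁿ (count d (y ∷ p₂) +ⁿ count d w′) ≡ 2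
        counts = trans (sym (trans (count-++ d (d ∷ p₁) ((y ∷ p₂) ++ w′))
            (cong (count d (d ∷ p₁) +ⁿ_) (count-++ d (y ∷ p₂) w′))))
          (trans (cong (count d) (sym g≡)) (lifting-Double dbl inj d∈g))
        d∈w′ : d ∈ w′
        d∈w′ with d ∈? w′
        ... | yes d∈ = d∈
        ... | no  d∉ = ⊥-elim (ℕ.<⇒≱ (ℕ.≤-reflexive (trans (sym counts)
          (trans (cong₂ (λ b c → count d (d ∷ p₁) +ⁿ (b +ⁿ c)) 
              (∉⇒count λ d∈ → m∩q (lookup p₂⊆ d∈) d∈q) (∉⇒count d∉)) (ℕ.+-identityʳ _))))
          (ℕ.≤-trans (⊆⇒count d (⊆.∷ˡ⁻ p₁⊆)) (once d∈q)))

-- Decomposition along the queue of open outer edges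

Suffix-disjoint : ∀ {o t i j m r} → (∀ {x} → x ∈ o → x ≤ t) → Suffix [] t i m → Suffix o (i +ⁿ t) j r →
  ∀ {x} → x ∈ m → x ∉ r
Suffix-disjoint {o} {t} {i} {j} {m} {r} o≤t sm (_ , bal) {x} x∈m
  with t<x , x≤ ← ∈-range⁻ t i (Suffix⇒∈range sm x∈m) =
  count⇒∉ {w = r} (trans (bal x) (cong₂ (λ c d → c +ⁿ 2 *ⁿ d)
    (∉⇒count {w = o} λ x∈o → ℕ.<⇒≱ t<x (o≤t x∈o)) (count-range-below (i +ⁿ t) j x≤)))

Suffix-length-injective : ∀ {t i j w} → Suffix [] t i w → Suffix [] t j w → i ≡ j
Suffix-length-injective {i = i} {j} s s′ = ℕ.*-cancelˡ-≡ i j 2 (trans (sym (length-Suffix s)) (length-Suffix s′))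

++-compare : ∀ (u : Word) {v} u′ {v′} → u ++ v ≡ u′ ++ v′ →
  (∃[ d ] u′ ≡ u ++ d × v ≡ d ++ v′) ⊎ (∃[ d ] u ≡ u′ ++ d × v′ ≡ d ++ v)
++-compare []      u′       eq = inj₁ (u′ , refl , eq)
++-compare (x ∷ u) []       eq = inj₂ (x ∷ u , refl , sym eq)
++-compare (x ∷ u) (y ∷ u′) eq with refl ← ∷-injectiveˡ eq with ++-compare u u′ (∷-injectiveʳ eq)
... | inj₁ (d , eq₁ , eq₂) = inj₁ (d , cong (x ∷_) eq₁ , eq₂)
... | inj₂ (d , eq₁ , eq₂) = inj₂ (d , cong (x ∷_) eq₁ , eq₂)

split-at-∈ : ∀ (v u : Word) → (∀ {x} → x ∈ u → x ∉ v) ⊎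
  (∃[ m ] ∃[ b ] ∃[ u′ ] u ≡ m ++ b ∷ u′ × (∀ {x} → x ∈ m → x ∉ v) × b ∈ v)
split-at-∈ v [] = inj₁ λ ()
split-at-∈ v (x ∷ u) with x ∈? v
... | yes x∈v = inj₂ ([] , x , u , refl , (λ ()) , x∈v)
... | no  x∉v with split-at-∈ v u
...   | inj₁ u∩v = inj₁ λ { (here refl) → x∉v ; (there y∈) → u∩v y∈ }
...   | inj₂ (m , b , u′ , refl , m∩v , b∈v) =
  inj₂ (x ∷ m , b , u′ , refl , (λ { (here refl) → x∉v ; (there y∈) → m∩v y∈ }) , b∈v)

-- No letter of q can be embedded at or after b, so b extends the embedding on the right. This is
-- what places a newly opened edge at the back of the queue.
⊆-∷ʳ : ∀ {q v : Word} {b} → q ⊆ v → b ∈ v → b ∉ q → (∀ {c} → c ∈ q → ¬ (b ∷ c ∷ [] ⊆ v)) → q ++ [ b ] ⊆ v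
⊆-∷ʳ {[]}    e          b∈          b∉ none = from∈ b∈
⊆-∷ʳ {c ∷ q} (_ ∷ʳ e)   (here refl) b∉ none = ⊥-elim (none (here refl) (refl ∷ from∈ (to∈ e)))
⊆-∷ʳ {c ∷ q} (_ ∷ʳ e)   (there b∈)  b∉ none = _ ∷ʳ ⊆-∷ʳ e b∈ b∉ λ c∈ bc → none c∈ (_ ∷ʳ bc)
⊆-∷ʳ {c ∷ q} (refl ∷ e) (here refl) b∉ none = ⊥-elim (b∉ (here refl))
⊆-∷ʳ {c ∷ q} (refl ∷ e) (there b∈)  b∉ none =
  refl ∷ ⊆-∷ʳ e b∈ (λ b∈q → b∉ (there b∈q)) λ c∈ bc → none (there c∈) (_ ∷ʳ bc)

Occurs-lifting : ∀ {π a m} → a ∉ m → 0 ∉ π → Occurs π m → Occurs (lifting π) (a ∷ m ++ [ a ])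
Occurs-lifting {π} {a} {m} a∉m 0∉π (f , inj , e) = f⁺ , inj⁺ , refl ∷ subst (_⊆ m ++ [ a ]) (sym map≡) (⊆.++⁺ e ⊆-refl)
  where
  f⁺ : ℕ → ℕ
  f⁺ (suc (suc x)) = f (suc x)
  -- The case meant is 1, the outer edge of the lifting. Since 0 ∉ π, the lifted letters are at
  -- least 2 and fall under the clause above.
  f⁺ _             = a
  f⁺-suc : ∀ {x} → x ∈ π → f⁺ (suc x) ≡ f x
  f⁺-suc {zero}  0∈ = ⊥-elim (0∉π 0∈)
  f⁺-suc {suc x} _  = refl
  map≡ : map f⁺ (map suc π ++ [ 1 ]) ≡ map f π ++ [ a ]
  map≡ = trans (map-++ f⁺ (map suc π) [ 1 ]) (cong (_++ [ a ])
    (trans (sym (map-∘ π)) (map-cong-local (All.tabulate f⁺-suc))))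
  view : ∀ {x} → x ∈ lifting π → x ≡ 1 ⊎ (∃[ y ] y ∈ π × x ≡ suc y)
  view (here x≡1) = inj₁ x≡1
  view (there x∈) with ∈-++⁻ (map suc π) x∈
  ... | inj₁ x∈′        = inj₂ (∈-map⁻ suc x∈′)
  ... | inj₂ (here x≡1) = inj₁ x≡1
  a≢f⁺ : ∀ {y} → y ∈ π → a ≢ f⁺ (suc y)
  a≢f⁺ y∈ eq = a∉m (lookup e (subst (_∈ map f π) (sym (trans eq (f⁺-suc y∈))) (∈-map⁺ f y∈)))
  inj⁺ : InjectiveOn (lifting π) f⁺
  inj⁺ x∈ y∈ eq with view x∈ | view y∈
  ... | inj₁ refl             | inj₁ refl             = refl
  ... | inj₁ refl             | inj₂ (y , y∈′ , refl) = ⊥-elim (a≢f⁺ y∈′ eq)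
  ... | inj₂ (x , x∈′ , refl) | inj₁ refl             = ⊥-elim (a≢f⁺ x∈′ (sym eq))
  ... | inj₂ (x , x∈′ , refl) | inj₂ (y , y∈′ , refl) =
    cong suc (inj x∈′ y∈′ (trans (sym (f⁺-suc x∈′)) (trans eq (f⁺-suc y∈′))))

record Queue (q : List ℕ) (t : ℕ) : Set where
  field
    once  : ∀ {x} → x ∈ q → count x q ≤ 1
    bound : ∀ {x} → x ∈ q → x ≤ t

open Queue

Queue-[] : ∀ {t} → Queue [] t
Queue-[] = record { once = λ () ; bound = λ () }

Queue-∉ : ∀ {a q t} → Queue (a ∷ q) t → a ∉ q
Queue-∉ {a} {q} Q a∈q = ℕ.<⇒≱ (count-twice {u = [ a ]} {q} (here refl) a∈q) (once Q (here refl))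

Queue-tail : ∀ {a q t} → Queue (a ∷ q) t → Queue q t
Queue-tail {a} {q} Q = record
  { once  = λ {x} x∈ → ℕ.≤-trans (⊆⇒count x (a ∷ʳ ⊆-refl {x = q})) (once Q (there x∈))
  ; bound = λ x∈ → bound Q (there x∈)
  }

Queue-weaken : ∀ {q s t} → s ≤ t → Queue q s → Queue q t
Queue-weaken s≤t Q = record { once = once Q ; bound = λ x∈ → ℕ.≤-trans (bound Q x∈) s≤t }

Queue-snoc : ∀ {q t} → Queue q t → Queue (q ++ [ suc t ]) (suc t)
Queue-snoc {q} {t} Q = record { once = once′ ; bound = bound′ }
  where
  bound′ : ∀ {x} → x ∈ q ++ [ suc t ] → x ≤ suc t
  bound′ x∈ with ∈-++⁻ q x∈
  ... | inj₁ x∈q         = ℕ.m≤n⇒m≤1+n (bound Q x∈q)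
  ... | inj₂ (here refl) = ℕ.≤-refl
  once′ : ∀ {x} → x ∈ q ++ [ suc t ] → count x (q ++ [ suc t ]) ≤ 1
  once′ {x} x∈ with ∈-++⁻ q x∈
  ... | inj₁ x∈q = subst (_≤ 1) (sym (trans (count-++ x q [ suc t ]) (trans
    (cong (count x q +ⁿ_) (count-other {x} {suc t} λ { refl → ℕ.1+n≰n (bound Q x∈q) })) (ℕ.+-identityʳ _)))) (once Q x∈q)
  ... | inj₂ (here refl) = ℕ.≤-reflexive (trans (count-++ (suc t) q [ suc t ])
    (cong₂ _+ⁿ_ (∉⇒count {w = q} λ x∈q → ℕ.1+n≰n (bound Q x∈q)) (count-self (suc t))))

module Decomposition {k : ℕ} {σ : Word} (matching : IsMatching k σ) (connected : Connected σ) where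

  inner outer : List Word
  inner = σ ∷ χ ∷ χ̄ ∷ []
  outer = lifting σ ∷ χ ∷ χ̄ ∷ []

  σ-suffix : Suffix [] 0 k σ
  σ-suffix = IsMatching⇒Suffix matching

  0∉σ : 0 ∉ σ
  0∉σ 0∈ with () ← proj₁ (∈-range⁻ 0 k (Suffix⇒∈range σ-suffix 0∈))

  -- A cut into factors without common letters separates no edge, so both factors are balanced. The
  -- order of first use makes the second a matching shifted by the order of the first, hence the
  -- whole a juxtaposition.
  σ-connected : ∀ u v → σ ≡ u ++ v → (∀ {x} → x ∈ u → x ∉ v) → u ≡ [] ⊎ v ≡ []
  σ-connected []      v       eq u∩v = inj₁ refl
  σ-connected (x ∷ u) []      eq u∩v = inj₂ refl
  σ-connected (x ∷ u) (y ∷ v) eq u∩v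
    with i , j , _ , su , sv ← Suffix-++⁻ (x ∷ u) (subst (Suffix [] 0 k) eq σ-suffix) u∩v (λ _ ())
    with β , sβ , v≡ ← Suffix-unshift sv =
    ⊥-elim (proj₂ connected (i , j , x ∷ u , β , Suffix⇒IsMatching su , Suffix⇒IsMatching sβ ,
      (λ ()) , nonempty v≡ , juxtaposed))
    where
    nonempty : ∀ {β f} → y ∷ v ≡ map f β → β ≢ []
    nonempty () refl
    order≡ : i +ⁿ 0 ≡ order (x ∷ u)
    order≡ = trans (ℕ.+-identityʳ i) (trans (ℕ.n≡⌊n+n/2⌋ i)
      (cong ⌊_/2⌋ (sym (trans (length-Suffix su) (cong (i +ⁿ_) (ℕ.+-identityʳ i))))))
    juxtaposed : σ ≡ juxtapose (x ∷ u) β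
    juxtaposed = trans eq (cong ((x ∷ u) ++_) (trans v≡ (cong (λ t → map (t +ⁿ_) β) order≡)))

  Free : List Word → Word → Set
  Free S τ = All (λ π → ¬ Occurs π τ) S

  Free-⊆ : ∀ {S τ τ′} → τ ⊆ τ′ → Free S τ′ → Free S τ
  Free-⊆ τ⊆ = All.map λ ¬o o → ¬o (Occurs-mono τ⊆ o)

  -- q w is a matching avoiding lifting σ, χ and χ̄. Each letter of q occurs
  -- only once in w, so that q ⊆ w says that the edges opened in q are closed in
  -- the same order, that is, that they are not nested.
  record Valid (q : List ℕ) (t n : ℕ) (w : Word) : Set where
    field
      suffix : Suffix q t n w
      queue  : q ⊆ w
      free   : Free outer (q ++ w)

  open Valid

  Suffix-once : ∀ {q t n w} → Queue q t → Suffix q t n w → ∀ {x} → x ∈ q → count x w ≤ 1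
  Suffix-once {q} {t} {n} Q (_ , bal) {x} x∈ = subst (_≤ 1) (sym (trans (bal x)
    (trans (cong (λ c → count x q +ⁿ 2 *ⁿ c) (count-range-below t n (bound Q x∈))) (ℕ.+-identityʳ _)))) (once Q x∈)

  -- What follows the content of a gap starts at a vertex of an outer edge. Only the oldest open
  -- edge a may close there; an edge that opens joins the queue at the back.
  Rest : ℕ → List ℕ → ℕ → ℕ → Word → Set
  Rest a q t j r = (∃[ w ] Valid q t j w × r ≡ a ∷ w) ⊎
    (∃[ j′ ] ∃[ w ] j ≡ suc j′ × Valid (a ∷ q ++ [ suc t ]) (suc t) j′ w × r ≡ suc t ∷ w)

  Rest⇒Valid : ∀ {a q t j r} → Queue (a ∷ q) t → Rest a q t j r → Valid (a ∷ q) t j r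
  Rest⇒Valid {a} {q} {t} {j} Q (inj₁ (w , V , refl)) = record
    { suffix = Suffix-close (suffix V) (bound Q (here refl))
    ; queue  = refl ∷ queue V
    ; free   = freed (free V)
    }
    where
    a∉w : a ∉ w
    a∉w = count⇒∉ {w = w} (trans (balanced (suffix V) a) (cong₂ (λ c d → c +ⁿ 2 *ⁿ d)
      (∉⇒count (Queue-∉ Q)) (count-range-below t j (bound Q (here refl)))))
    open Front (Queue-∉ Q) a∉w (queue V) (once (Queue-tail Q)) (Suffix-once (Queue-tail Q) (suffix V))
    freed : Free outer (q ++ w) → Free outer (a ∷ q ++ a ∷ w)
    freed (¬l ∷ ¬χ ∷ ¬χ̄ ∷ []) =
      (λ o → ¬l (lifting-front 0∉σ (proj₁ connected) (Suffix⇒Double σ-suffix) o)) ∷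
      (λ o → ¬χ (χ-front o)) ∷ (λ o → ¬χ̄ (χ̄-front o)) ∷ []
  Rest⇒Valid {a} {q} {t} Q (inj₂ (j′ , w , refl , V , refl)) = record
    { suffix = Suffix-open (suffix V)
    ; queue  = suc t ∷ʳ ⊆-trans (⊆.++⁺ʳ [ suc t ] ⊆-refl) (queue V)
    -- Opening passes a letter from the remaining word to the queue and leaves their concatenation
    -- unchanged.
    ; free   = subst (Free outer) (++-assoc (a ∷ q) [ suc t ] w) (free V)
    }

  compose : ∀ {a q t i j v r} → Queue (a ∷ q) t → AvoidingMatching inner i v → Rest a q (i +ⁿ t) j r →
    Valid (a ∷ q) t (i +ⁿ j) (map (t +ⁿ_) v ++ r)
  compose {a} {q} {t} {i} {j} {v} {r} Q (mv , av) R = record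
    { suffix = Suffix-++ sm (suffix V)
    ; queue  = ⊆.++⁺ˡ m (queue V)
    ; free   = freed av (free V)
    }
    where
    m : Word
    m = map (t +ⁿ_) v
    sm : Suffix [] t i m
    sm = Suffix-shift t (IsMatching⇒Suffix mv)
    Q′ : Queue (a ∷ q) (i +ⁿ t)
    Q′ = Queue-weaken (ℕ.m≤n+m t i) Q
    V : Valid (a ∷ q) (i +ⁿ t) j r
    V = Rest⇒Valid Q′ R
    open Insert {a ∷ q} {m} {r} (queue V) (once Q) (Suffix-once Q′ (suffix V))
      (λ x∈m x∈q → ℕ.<⇒≱ (proj₁ (∈-range⁻ t i (Suffix⇒∈range sm x∈m))) (bound Q x∈q))
      (Suffix-disjoint (bound Q) sm (suffix V))
    reduce : ∀ {π} → v Avoids π → ¬ Occurs π m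
    reduce ¬p o = ¬p (Occurs⇒IsPatternOf (Occurs-unshift t o))
    freed : All (v Avoids_) inner → Free outer (a ∷ q ++ r) → Free outer (a ∷ q ++ m ++ r)
    freed (¬σ ∷ ¬χ ∷ ¬χ̄ ∷ []) (¬l′ ∷ ¬χ′ ∷ ¬χ̄′ ∷ []) =
      (λ o → [ reduce ¬σ , ¬l′ ]′ (lifting-insert 0∉σ (Suffix⇒Double σ-suffix) σ-connected o)) ∷
      (λ o → [ reduce ¬χ , ¬χ′ ]′ (Rigid-insert χ-Rigid o)) ∷
      (λ o → [ reduce ¬χ̄ , ¬χ̄′ ]′ (Rigid-insert χ̄-Rigid o)) ∷ []

  -- If d were nonempty, r would begin with a letter of m′. This is not a, since the letters of m′
  -- exceed t. If it has just been opened, its second copy also lies in d, because m′ and r′ are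
  -- disjoint; but a is closed before it, so a would lie in d too.
  decomposition-unique-≤ : ∀ {a q t i i′ j j′ m m′ r r′} → Queue (a ∷ q) t → Suffix [] t i m → Suffix [] t i′ m′ →
    Rest a q (i +ⁿ t) j r → Rest a q (i′ +ⁿ t) j′ r′ → ∀ d → m′ ≡ m ++ d → r ≡ d ++ r′ → m ≡ m′
  decomposition-unique-≤ Q sm sm′ R R′ [] eq _ = sym (trans eq (++-identityʳ _))
  decomposition-unique-≤ {a} {t = t} {i′ = i′} {m = m} Q sm sm′ (inj₁ (w , V , refl)) R′ (b ∷ d) refl eq =
    ⊥-elim (ℕ.<⇒≱ (proj₁ (∈-range⁻ t i′ (Suffix⇒∈range sm′ (∈-++⁺ʳ m (here (∷-injectiveˡ eq)))))) (bound Q (here refl)))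
  decomposition-unique-≤ {a} {q} {t} {i} {i′} {m = m} Q sm sm′ (inj₂ (j , w , refl , V , refl)) R′ (b ∷ d) refl eq
    with refl , refl ← ∷-injective eq
    with ⊆-++⁻ d (⊆-trans (refl ∷ ⊆.++⁺ˡ q ⊆-refl) (queue V))
  ... | []     , _ , refl , _  , e = ⊥-elim (Suffix-disjoint (bound Q) sm′
    (suffix (Rest⇒Valid (Queue-weaken (ℕ.m≤n+m t i′) Q) R′)) (∈-++⁺ʳ m (here refl)) (lookup e (there (here refl))))
  ... | _ ∷ _ , _ , eq′ , e , _ with refl ← ∷-injectiveˡ eq′ =
    ⊥-elim (ℕ.<⇒≱ (proj₁ (∈-range⁻ t i′ (Suffix⇒∈range sm′ (∈-++⁺ʳ m (there (to∈ e)))))) (bound Q (here refl)))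

  decomposition-unique : ∀ {a q t i i′ j j′ m m′ r r′} → Queue (a ∷ q) t → Suffix [] t i m → Suffix [] t i′ m′ →
    Rest a q (i +ⁿ t) j r → Rest a q (i′ +ⁿ t) j′ r′ → m ++ r ≡ m′ ++ r′ → m ≡ m′
  decomposition-unique {m = m} {m′} Q sm sm′ R R′ eq with ++-compare m m′ eq
  ... | inj₁ (d , eq₁ , eq₂) = decomposition-unique-≤ Q sm sm′ R R′ d eq₁ eq₂
  ... | inj₂ (d , eq₁ , eq₂) = sym (decomposition-unique-≤ Q sm′ sm R′ R d eq₁ eq₂)

  -- Write w = u a v. The next vertex b of an outer edge is the first letter of
  -- u that reappears in v, or a if there is none. An edge x opened before b and
  -- closed after it would form χ̄ with a and b, so the letters before b form a
  -- closed word m; and b is closed after all of q, since otherwise it would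
  -- form χ with a and some c in q.
  decompose : ∀ {a q t n w} → Queue (a ∷ q) t → Valid (a ∷ q) t n w →
    ∃[ i ] ∃[ j ] ∃[ v ] ∃[ r ] n ≡ i +ⁿ j × AvoidingMatching inner i v × Rest a q (i +ⁿ t) j r × w ≡ map (t +ⁿ_) v ++ r
  decompose {a} {q} {t} {n} {w} Q V with u , v , refl , q⊆v ← ⊆-∷⁻ (queue V) = conclude (split-at-∈ v u)
    where
    once-w : ∀ {x} → x ∈ a ∷ q → count x (u ++ a ∷ v) ≤ 1
    once-w = Suffix-once Q (suffix V)
    a∉u : a ∉ u
    a∉u a∈u = ℕ.<⇒≱ (count-twice {u = u} {a ∷ v} a∈u (here refl)) (once-w (here refl))
    a≢ : ∀ {x} → x ∈ u → a ≢ x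
    a≢ x∈ refl = a∉u x∈
    Goal : Word → Set
    Goal w = ∃[ i ] ∃[ j ] ∃[ v ] ∃[ r ]
      n ≡ i +ⁿ j × AvoidingMatching inner i v × Rest a q (i +ⁿ t) j r × w ≡ map (t +ⁿ_) v ++ r
    finish : ∀ m r → u ++ a ∷ v ≡ m ++ r → a ∈ r → (∀ {x} → x ∈ m → x ∉ r) → (∀ {x} → x ∈ m → x ∉ a ∷ q) →
      (∀ {i j} → Suffix (a ∷ q) (i +ⁿ t) j r → Free outer (a ∷ q ++ r) → Rest a q (i +ⁿ t) j r) → Goal (u ++ a ∷ v)
    finish m r w≡ a∈r m∩r m∩q rest
      with i , j , n≡ , sm , sr ← Suffix-++⁻ m (subst (Suffix (a ∷ q) t n) w≡ (suffix V)) m∩r m∩q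
      with v′ , sv , m≡ ← Suffix-unshift sm =
      i , j , v′ , r , n≡ , (Suffix⇒IsMatching sv , avoids free′) ,
        rest {i} {j} sr (Free-⊆ (⊆.++⁺ (⊆-refl {x = a ∷ q}) (⊆.++⁺ˡ m (⊆-refl {x = r}))) free′) , trans w≡ (cong (_++ r) m≡)
      where
      free′ : Free outer (a ∷ q ++ m ++ r)
      free′ = subst (λ w → Free outer (a ∷ q ++ w)) w≡ (free V)
      shift : ∀ {π} → π IsPatternOf v′ → Occurs π m
      shift p = subst (Occurs _) (sym m≡) (Occurs-shift t (IsPatternOf⇒Occurs p))
      avoids : Free outer (a ∷ q ++ m ++ r) → All (v′ Avoids_) inner
      avoids (¬l ∷ ¬χ ∷ ¬χ̄ ∷ []) =
        (λ p → ¬l (Occurs-mono (refl ∷ ⊆.++⁺ˡ q (⊆.++⁺ (⊆-refl {x = m}) (from∈ a∈r)))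
          (Occurs-lifting (λ a∈m → m∩q a∈m (here refl)) 0∉σ (shift p)))) ∷
        (λ p → ¬χ (Occurs-mono (⊆.++⁺ˡ (a ∷ q) (⊆.++⁺ʳ r (⊆-refl {x = m}))) (shift p))) ∷
        (λ p → ¬χ̄ (Occurs-mono (⊆.++⁺ˡ (a ∷ q) (⊆.++⁺ʳ r (⊆-refl {x = m}))) (shift p))) ∷ []
    conclude : (∀ {x} → x ∈ u → x ∉ v) ⊎ (∃[ m ] ∃[ b ] ∃[ u′ ] u ≡ m ++ b ∷ u′ × (∀ {x} → x ∈ m → x ∉ v) × b ∈ v) →
      Goal (u ++ a ∷ v)
    conclude (inj₁ u∩v) = finish u (a ∷ v) refl (here refl)
      (λ { x∈ (here refl) → a∉u x∈ ; x∈ (there x∈v) → u∩v x∈ x∈v })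
      (λ { x∈ (here refl) → a∉u x∈ ; x∈ (there x∈q) → u∩v x∈ (lookup q⊆v x∈q) })
      λ {i} s f → inj₁ (v , record
        { suffix = Suffix-close⁻ s (ℕ.≤-trans (bound Q (here refl)) (ℕ.m≤n+m t i))
        ; queue  = q⊆v
        ; free   = Free-⊆ (a ∷ʳ ⊆.++⁺ (⊆-refl {x = q}) (a ∷ʳ ⊆-refl)) f
        } , refl)
    conclude (inj₂ (m , b , u′ , u≡ , m∩v , b∈v)) = finish m (b ∷ u′ ++ a ∷ v)
      (trans (cong (_++ a ∷ v) u≡) (++-assoc m (b ∷ u′) (a ∷ v))) (there (∈-++⁺ʳ u′ (here refl)))
      m∩r (λ { x∈ (here refl) → a∉u (m⊆u x∈) ; x∈ (there x∈q) → m∩v x∈ (lookup q⊆v x∈q) })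
      rest
      where
      m⊆u : ∀ {x} → x ∈ m → x ∈ u
      m⊆u x∈ = subst (_ ∈_) (sym u≡) (∈-++⁺ˡ x∈)
      b∈u : b ∈ u
      b∈u = subst (b ∈_) (sym u≡) (∈-++⁺ʳ m (here refl))
      m∩u′ : ∀ {x} → x ∈ m → x ∉ u′
      m∩u′ {x} x∈m x∈u′ = All.lookup (free V) (there (there (here refl))) (occurs-χ̄ (a≢ (m⊆u x∈m)) (a≢ b∈u)
        (λ { refl → m∩v x∈m b∈v })
        (refl ∷ ⊆.++⁺ˡ q (⊆.++⁺ {as = x ∷ b ∷ x ∷ []} (subst (_ ⊆_) (sym u≡) (⊆.++⁺ (from∈ x∈m) (refl ∷ from∈ x∈u′)))
          (refl ∷ from∈ b∈v))))
      m∩r : ∀ {x} → x ∈ m → x ∉ b ∷ u′ ++ a ∷ v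
      m∩r x∈ (here refl) = m∩v x∈ b∈v
      m∩r x∈ (there x∈′) with ∈-++⁻ u′ x∈′
      ... | inj₁ x∈u′         = m∩u′ x∈ x∈u′
      ... | inj₂ (here refl)  = a∉u (m⊆u x∈)
      ... | inj₂ (there x∈v)  = m∩v x∈ x∈v
      b∉q : b ∉ q
      b∉q b∈q = ℕ.<⇒≱ (count-twice {u = u} {a ∷ v} b∈u (there b∈v)) (once-w (there b∈q))
      not-before : ∀ {c} → c ∈ q → ¬ (b ∷ c ∷ [] ⊆ v)
      not-before c∈q bc = All.lookup (free V) (there (here refl)) (occurs-χ
        (λ { refl → Queue-∉ Q c∈q }) (a≢ b∈u) (λ { refl → b∉q c∈q })
        (refl ∷ ⊆.++⁺ (from∈ c∈q) (⊆.++⁺ (from∈ b∈u) (refl ∷ bc))))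
      rest : ∀ {i j} → Suffix (a ∷ q) (i +ⁿ t) j (b ∷ u′ ++ a ∷ v) → Free outer (a ∷ q ++ b ∷ u′ ++ a ∷ v) →
        Rest a q (i +ⁿ t) j (b ∷ u′ ++ a ∷ v)
      rest s f with j′ , refl , refl , s′ ← Suffix-open⁻ s (λ { (here refl) → a∉u b∈u ; (there b∈q) → b∉q b∈q }) =
        inj₂ (j′ , u′ ++ a ∷ v , refl , record
          { suffix = s′
          ; queue  = ⊆.++⁺ˡ u′ (refl ∷ ⊆-∷ʳ q⊆v b∈v b∉q not-before)
          ; free   = subst (Free outer) (sym (++-assoc (a ∷ q) [ b ] (u′ ++ a ∷ v))) f
          } , refl)

-- Generating functions of the continuations at a given queue

module Counting {k : ℕ} {σ : Word} (matching : IsMatching k σ) (connected : Connected σ) where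

  open Decomposition matching connected
  open Valid

  M A : Series
  M = 𝓜[ inner ]
  A = 𝓜[ outer ]

  Count-𝓜 : ∀ S n → Count (AvoidingMatching S n) (𝓜[ S ] n)
  Count-𝓜 S n = record
    { list = 𝓜 S n ; unique = 𝓜-unique S n ; sound = 𝓜-sound S n ; complete = 𝓜-complete S n ; size = refl }

  -- With no edge open, the letters used before merely shift the alphabet, so the count does not
  -- depend on t.
  Count-empty-queue : ∀ t n → Count (Valid [] t n) (A n)
  Count-empty-queue t n = Count-resp to from refl
    (Count-map (map (t +ⁿ_)) (map-injective λ {x} {y} → ℕ.+-cancelˡ-≡ t x y) (Count-𝓜 outer n))
    where
    to : ∀ {w} → ∃[ v ] AvoidingMatching outer n v × w ≡ map (t +ⁿ_) v → Valid [] t n w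
    to (v , (mv , av) , refl) = record
      { suffix = Suffix-shift t (IsMatching⇒Suffix mv)
      ; queue  = minimum _
      ; free   = All.map (λ ¬p o → ¬p (Occurs⇒IsPatternOf (Occurs-unshift t o))) av
      }
    from : ∀ {w} → Valid [] t n w → ∃[ v ] AvoidingMatching outer n v × w ≡ map (t +ⁿ_) v
    from V with v , sv , refl ← Suffix-unshift (suffix V) =
      v , (Suffix⇒IsMatching sv , All.map (λ ¬o p → ¬o (Occurs-shift t (IsPatternOf⇒Occurs p))) (free V)) , refl

  -- The claimed solution is taken as the definition: descend to the empty queue, then continue with
  -- any matching counted by A. `Count-Valid` proves that it counts the continuations.
  F : ℕ → Series
  F h = A *ˢ descent M h

  F-zero : A ≈ F 0
  F-zero = ≈-sym (≈-trans (*ˢ-cong {A} ≈-refl (descent-zero M)) (≈-trans (*ˢ-comm A 1ˢ) (*ˢ-identityˡ A)))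

  F-suc : ∀ h → M *ˢ (F h +ˢ z *ˢ F (2 +ⁿ h)) ≈ F (suc h)
  F-suc h = ≈-sym (descent-suc M A h)

  -- The count after an opening is requested only for a successor j, since an opening uses up one
  -- new letter. This accounts for the factor z and lets the recursion in `Count-Valid` descend.
  Count-Rest : ∀ {a q t} j → a ≤ t → Count (Valid q t j) (F (length q) j) →
    (∀ {j′} → j ≡ suc j′ → Count (Valid (a ∷ q ++ [ suc t ]) (suc t) j′) (F (2 +ⁿ length q) j′)) →
    Count (Rest a q t j) ((F (length q) +ˢ z *ˢ F (2 +ⁿ length q)) j)
  Count-Rest {a} {q} {t} j a≤t closing opening =
    Count-⊎ (λ { (w , _ , refl) (j′ , w′ , _ , _ , eq) → ℕ.1+n≰n (subst (_≤ t) (∷-injectiveˡ eq) a≤t) })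
      (Count-map (a ∷_) ∷-injectiveʳ closing) (Count-opening j opening)
    where
    Count-opening : ∀ j → (∀ {j′} → j ≡ suc j′ → Count (Valid (a ∷ q ++ [ suc t ]) (suc t) j′) (F (2 +ⁿ length q) j′)) →
      Count (λ r → ∃[ j′ ] ∃[ w ] j ≡ suc j′ × Valid (a ∷ q ++ [ suc t ]) (suc t) j′ w × r ≡ suc t ∷ w)
            ((z *ˢ F (2 +ⁿ length q)) j)
    Count-opening zero    opening = subst (Count _) (sym (ℤ.*-zeroˡ (F (2 +ⁿ length q) 0))) (Count-∅ λ { (_ , _ , () , _) })
    Count-opening (suc j) opening = Count-resp
      (λ { (w , V , eq) → j , w , refl , V , eq }) (λ { (.j , w , refl , V , eq) → w , V , eq })
      (sym (z*ˢ-suc (F (2 +ⁿ length q)) j)) (Count-map (suc t ∷_) ∷-injectiveʳ (opening refl))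

  -- The number of letters still to be read, 2 n + length q, decreases.
  Count-Valid : ∀ fuel {q t} n → Queue q t → n +ⁿ n +ⁿ length q < fuel → Count (Valid q t n) (F (length q) n)
  Count-Valid (suc fuel) {[]} {t} n Q _ = Count-resp (λ V → V) (λ V → V)
    (F-zero n)
    (Count-empty-queue t n)
  Count-Valid (suc fuel) {a ∷ q} {t} n Q (s≤s n≤fuel) =
    Count-resp {c = (M *ˢ G) n} to from (F-suc (length q) n)
      (Count-∑≤ n {Part} {c = λ i → M i * G (n ∸ i)} part-unique Count-part)
    where
    G : Series
    G = F (length q) +ˢ z *ˢ F (2 +ⁿ length q)
    -- Grouping the words by the order i of the gap content gives the summands of the Cauchy product
    -- of M and G.
    Part : ℕ → Word → Set
    Part i w = ∃[ v ] v ∈ 𝓜 inner i × (∃[ r ] Rest a q (i +ⁿ t) (n ∸ i) r × w ≡ map (t +ⁿ_) v ++ r)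
    to : ∀ {w} → ∃[ i ] i ≤ n × Part i w → Valid (a ∷ q) t n w
    to (i , i≤n , v , v∈ , r , R , refl) = subst (λ n → Valid (a ∷ q) t n (map (t +ⁿ_) v ++ r)) (ℕ.m+[n∸m]≡n i≤n)
      (compose Q (𝓜-sound inner i v∈) R)
    from : ∀ {w} → Valid (a ∷ q) t n w → ∃[ i ] i ≤ n × Part i w
    from V =
      let i , j , v , r , n≡ , av , R , eq = decompose Q V
      in i , subst (i ≤_) (sym n≡) (ℕ.m≤m+n i j) , v , 𝓜-complete inner i av , r ,
         subst (λ l → Rest a q (i +ⁿ t) l r) (sym (trans (cong (_∸ i) n≡) (ℕ.m+n∸m≡n i j))) R , eq
    closed : ∀ i {v} → v ∈ 𝓜 inner i → Suffix [] t i (map (t +ⁿ_) v)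
    closed i v∈ = Suffix-shift t (IsMatching⇒Suffix (proj₁ (𝓜-sound inner i v∈)))
    part-unique : ∀ {i i′ w} → Part i w → Part i′ w → i ≡ i′
    part-unique {i} {i′} (v , v∈ , r , R , refl) (v′ , v∈′ , r′ , R′ , eq) =
      Suffix-length-injective (closed i v∈) (subst (Suffix [] t i′)
        (sym (decomposition-unique Q (closed i v∈) (closed i′ v∈′) R R′ eq)) (closed i′ v∈′))
    first-unique : ∀ {i v v′ w} → v ∈ 𝓜 inner i → v′ ∈ 𝓜 inner i →
      (∃[ r ] Rest a q (i +ⁿ t) (n ∸ i) r × w ≡ map (t +ⁿ_) v ++ r) →
      (∃[ r ] Rest a q (i +ⁿ t) (n ∸ i) r × w ≡ map (t +ⁿ_) v′ ++ r) → v ≡ v′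
    first-unique {i} v∈ v∈′ (r , R , refl) (r′ , R′ , eq) =
      map-injective (λ {x} {y} → ℕ.+-cancelˡ-≡ t x y) (decomposition-unique Q (closed i v∈) (closed i v∈′) R R′ eq)
    Count-rest : ∀ i → i ≤ n → Count (Rest a q (i +ⁿ t) (n ∸ i)) ((F (length q) +ˢ z *ˢ F (2 +ⁿ length q)) (n ∸ i))
    Count-rest i i≤n = Count-Rest (n ∸ i) (bound Q′ (here refl))
      (Count-Valid fuel (n ∸ i) (Queue-tail Q′)
        (ℕ.<-≤-trans (ℕ.≤-reflexive (sym (ℕ.+-suc _ (length q)))) (ℕ.≤-trans
          (ℕ.+-monoˡ-≤ (suc (length q)) (ℕ.+-mono-≤ (ℕ.m∸n≤m n i) (ℕ.m∸n≤m n i))) n≤fuel)))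
      λ {j′} eq → subst (λ l → Count (Valid (a ∷ q ++ [ suc (i +ⁿ t) ]) (suc (i +ⁿ t)) j′) (F l j′)) length≡
        (Count-Valid fuel j′ (Queue-snoc Q′) (subst (λ l → j′ +ⁿ j′ +ⁿ l < fuel) (sym length≡)
          (ℕ.<-≤-trans (ℕ.≤-reflexive (smaller j′ (length q))) (ℕ.≤-trans
            (ℕ.+-monoˡ-≤ (suc (length q)) (ℕ.+-mono-≤ (bounded eq) (bounded eq))) n≤fuel))))
      where
      Q′ : Queue (a ∷ q) (i +ⁿ t)
      Q′ = Queue-weaken (ℕ.m≤n+m t i) Q
      length≡ : length (a ∷ q ++ [ suc (i +ⁿ t) ]) ≡ 2 +ⁿ length q
      length≡ = cong suc (trans (length-++ q) (ℕ.+-comm (length q) 1))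
      smaller : ∀ j l → suc (j +ⁿ j +ⁿ (2 +ⁿ l)) ≡ suc j +ⁿ suc j +ⁿ suc l
      smaller = ℕ.solve-∀
      bounded : ∀ {j′} → n ∸ i ≡ suc j′ → suc j′ ≤ n
      bounded eq = subst (_≤ n) eq (ℕ.m∸n≤m n i)

    Count-part : ∀ i → i ≤ n → Count (Part i) (M i * G (n ∸ i))
    Count-part i i≤n = Count-∈ (𝓜-unique inner i) {c = G (n ∸ i)} (first-unique {i}) λ {v} v∈ →
      Count-map (map (t +ⁿ_) v ++_) (++-cancelˡ (map (t +ⁿ_) v) _ _) (Count-rest i i≤n)

  Valid-first : ∀ {n w} → Valid [] 0 (suc n) w → ∃[ w′ ] Valid [ 1 ] 1 n w′ × w ≡ 1 ∷ w′
  Valid-first {w = []}    V with () ← ordered (suffix V)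
  Valid-first {w = _ ∷ w} V with n , refl , refl , s ← Suffix-open⁻ (suffix V) (λ ()) = w , record
    { suffix = s
    ; queue  = from∈ (count⇒∈ (subst (1 ≤_) (sym (balanced s 1)) (s≤s z≤n)))
    ; free   = free V
    } , refl

  first-Valid : ∀ {n w} → ∃[ w′ ] Valid [ 1 ] 1 n w′ × w ≡ 1 ∷ w′ → Valid [] 0 (suc n) w
  first-Valid (w , V , refl) = record { suffix = Suffix-open (suffix V) ; queue = minimum _ ; free = free V }

  A-zero : A 0 ≡ 1ℤ
  A-zero = Count-functional (Count-𝓜 outer 0) (record
    { list     = [ [] ]
    ; unique   = [] ∷ []
    ; sound    = λ { (here refl) → (refl , [] , refl) , none ∷ none ∷ none ∷ [] }
    ; complete = λ { {[]} _ → here refl ; {_ ∷ _} ((() , _) , _) }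
    ; size     = refl
    })
    where
    none : ∀ {x π} → [] Avoids (x ∷ π)
    none (() ∷ _ , _)

  -- At an empty queue `Count-Valid` only returns A. Reading the first letter 1 leads to a queue of
  -- length one instead, and comparing the two counts gives an equation for A itself.
  A-suc : ∀ n → A (suc n) ≡ F 1 n
  A-suc n = Count-functional (Count-empty-queue 0 (suc n)) (Count-resp first-Valid Valid-first refl
    (Count-map (1 ∷_) ∷-injectiveʳ (Count-Valid _ n (Queue-snoc Queue-[]) (ℕ.n<1+n _))))

  A-equation : A ≈ 1ˢ +ˢ z *ˢ F 1
  A-equation zero    = A-zero
  A-equation (suc n) = trans (A-suc n) (sym (trans (ℤ.+-identityˡ _) (z*ˢ-suc (F 1) n)))

-- Adding A D to both sides removes the subtraction and leaves semiring identities; A D is then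
-- cancelled coefficient by coefficient in ℤ.
≈1/-intro : ∀ A D → A ≈ 1ˢ +ˢ A *ˢ D → A ≈1/ (1ˢ -ˢ D)
≈1/-intro A D A≈ n = ∙-cancelʳ ((A *ˢ D) n) _ _ (begin
  (A *ˢ (1ˢ -ˢ D)) n + (A *ˢ D) n   ≡⟨ solve 3 (λ a b d → a :* b :+ a :* d := a :* (b :+ d)) ≈-refl A (1ˢ -ˢ D) D n ⟩
  (A *ˢ (1ˢ -ˢ D +ˢ D)) n           ≡⟨ *ˢ-cong {A} ≈-refl (λ i → cancel (1ˢ i) (D i)) n ⟩
  (A *ˢ 1ˢ) n                       ≡⟨ trans (*ˢ-comm A 1ˢ n) (*ˢ-identityˡ A n) ⟩
  A n                               ≡⟨ A≈ n ⟩
  1ˢ n + (A *ˢ D) n                 ∎)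
  where
  cancel : ∀ a d → a - d + d ≡ a
  cancel = ℤ.solve-∀

geometric : ∀ A M → A ≈ 1ˢ +ˢ z *ˢ (A *ˢ descent M 1) → A ≈1/ (1ˢ -ˢ z *ˢ M *ˢ (catalan ⟨ z *ˢ M ^ˢ 2 ⟩))
geometric A M A≈ = ≈1/-intro A (z *ˢ M *ˢ (catalan ⟨ z *ˢ M ^ˢ 2 ⟩)) (≈-trans A≈
  (+ˢ-cong {1ˢ} ≈-refl (≈-trans
    (solve 3 (λ z a d → z :* (a :* d) := a :* (z :* d)) ≈-refl z A (descent M 1))
    (*ˢ-cong {A} ≈-refl (descent-one M)))))

theorem2 : (k : ℕ) (σ : Word) → IsMatching k σ → Connected σ →
    let M = 𝓜[ σ ∷ χ ∷ χ̄ ∷ [] ] in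
    𝓜[ lifting σ ∷ χ ∷ χ̄ ∷ [] ] ≈1/ (1ˢ -ˢ z *ˢ M *ˢ (catalan ⟨ z *ˢ M ^ˢ 2 ⟩))
theorem2 k σ matching connected = geometric A M A-equation
  where open Counting matching connected
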